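{- Let $\bar a$ be a composition with an even number of parts. If $\bar a$ is not of the form $(a,1,a,1)$ or $(1,a,1,a)$ for some positive integer $a$, then the rank polynomial of the circular fence poset $\bar F(\bar a)$ is unimodal.
   Context: A composition is a finite tuple of positive integers. For an even-length composition $\bar c=(c_1,\dots,c_{2s})$ with $n=c_1+\dots+c_{2s}$, the circular fence poset $\bar F(\bar c)$ is the poset on elements $x_1,\dots,x_n$ (indices cyclic, $x_{n+1}=x_1$) generated by the relations $$x_1\prec x_2\prec\dots\prec x_{c_1+1}\succ x_{c_1+2}\succ\dots\succ x_{c_1+c_2+1}\prec x_{c_1+c_2+2}\prec\dots\prec x_{1+\sum_{i=1}^{2s-1}c_i}\succ\dots\succ x_{n}\succ x_1,$$ i.e. going around the cycle one takes $c_1$ up steps, then $c_2$ down steps, then $c_3$ up steps, and so on. The rank polynomial of a finite poset $P$ is $\sum_I q^{|I|}$, summed over all lower ideals (down-closed subsets) $I$ of $P$. A polynomial $\sum_k r_kq^k$ of degree $n$ is unimodal if there is an $m$ with $r_0\le r_1\le\dots\le r_m\ge r_{m+1}\ge\dots\ge r_n$. -}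

module Defs where

open import Level using (0ℓ)
open import Data.Nat.Base using (ℕ; zero; suc; _+_; _≤_; _<_; z≤n; s≤s)
open import Data.Nat.Properties as ℕ using ()
open import Data.Nat.Induction using (Acc; acc; <-wellFounded)
open import Data.Nat.Divisibility using (_∣_; ∣m+n∣m⇒∣n; ∣-refl; ∣⇒≤)
open import Data.Nat.DivMod using (_mod_; _%_; m<n⇒m%n≡m; n%n≡0)
open import Data.Nat.ListAction using (sum)
open import Data.Fin.Base using (Fin; zero; suc; toℕ; fromℕ; inject₁)
open import Data.Fin.Properties as Fin using (all?; any?)
open import Data.Fin.Relation.Unary.Top using (view; ‵fromℕ; ‵inject₁)
open import Data.Fin.Subset using (Subset; _∈_; ∣_∣; inside; outside)
open import Data.Fin.Subset.Properties using (_∈?_)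
open import Data.List.Base using (List; []; _∷_; _++_; [_]; map; filter; length)
open import Data.List.Relation.Unary.All using (All; []; _∷_)
open import Data.Vec.Base as Vec using (Vec; []; _∷_; lookup; replicate)
open import Data.Product using (∃-syntax; _×_; _,_)
open import Data.Sum using (inj₁; inj₂)
open import Data.Empty using (⊥-elim)
open import Relation.Nullary using (Dec; yes; no)
open import Relation.Nullary.Decidable using (map′; _×-dec_; _⊎-dec_; _→-dec_)
open import Relation.Unary using (Decidable)
open import Relation.Binary.Core using (Rel)
open import Relation.Binary.Structures using (IsDecPartialOrder)
open import Relation.Binary.Construct.Closure.ReflexiveTransitive
  using (Star; ε; _◅_; _◅◅_)
open import Relation.Binary.PropositionalEquality
  using (_≡_; _≢_; refl; sym; trans; cong; subst; isEquivalence)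

-- A polynomial is given by its coefficients, k ↦ r_k; its finiteness is part
-- of HasDegree.

Polynomial : Set
Polynomial = ℕ → ℕ

HasDegree : Polynomial → ℕ → Set
HasDegree r n = r n ≢ 0 × (∀ k → n < k → r k ≡ 0)

Unimodal : Polynomial → Set
Unimodal r = ∃[ n ] HasDegree r n × ∃[ m ] m ≤ n
  × (∀ k → k < m → r k ≤ r (suc k))
  × (∀ k → m ≤ k → k < n → r (suc k) ≤ r k)

record FinPoset (n : ℕ) : Set₁ where
  infix 4 _≼_
  field
    _≼_               : Rel (Fin n) 0ℓ
    isDecPartialOrder : IsDecPartialOrder _≡_ _≼_
  open IsDecPartialOrder isDecPartialOrder public
    using () renaming (_≤?_ to _≼?_)

module _ {n : ℕ} (P : FinPoset n) where
  open FinPoset P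

  IsLowerIdeal : Subset n → Set
  IsLowerIdeal I = ∀ x y → x ≼ y → y ∈ I → x ∈ I

  isLowerIdeal? : Decidable IsLowerIdeal
  isLowerIdeal? I =
    all? λ x → all? λ y → (x ≼? y) →-dec ((y ∈? I) →-dec (x ∈? I))

subsets : ∀ n → List (Subset n)
subsets zero    = [ [] ]
subsets (suc n) = map (outside ∷_) (subsets n) ++ map (inside ∷_) (subsets n)

lowerIdeals : ∀ {n} → FinPoset n → List (Subset n)
lowerIdeals {n} P = filter (isLowerIdeal? P) (subsets n)

-- The coefficient of q^k in Σ_I q^∣I∣ is the number of lower ideals of size k.

rankPolynomial : ∀ {n} → FinPoset n → Polynomial
rankPolynomial P k = length (filter (λ I → ∣ I ∣ ℕ.≟ k) (lowerIdeals P))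

record Composition : Set where
  field
    parts    : List ℕ
    positive : All (0 <_) parts

  size : ℕ
  size = sum parts

data Direction : Set where
  up down : Direction

opposite : Direction → Direction
opposite up   = down
opposite down = up

_≟ᵈ_ : (d e : Direction) → Dec (d ≡ e)
up   ≟ᵈ up   = yes refl
up   ≟ᵈ down = no λ ()
down ≟ᵈ up   = no λ ()
down ≟ᵈ down = yes refl

steps : Direction → (cs : List ℕ) → Vec Direction (sum cs)
steps d []       = []
steps d (c ∷ cs) = replicate c d Vec.++ steps (opposite d) cs

next : ∀ {n} → Fin n → Fin n
next {suc n} i = suc (toℕ i) mod suc n

-- The element x_{i+1} is represented by i : Fin n, and the i-th direction
-- is that of the step from i to its cyclic successor.

data Step {n} (ds : Vec Direction n) : Rel (Fin n) 0ℓ where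
  ascend  : ∀ {i} → lookup ds i ≡ up   → Step ds i (next i)
  descend : ∀ {i} → lookup ds i ≡ down → Step ds (next i) i

_≼[_]_ : ∀ {n} → Fin n → Vec Direction n → Fin n → Set
i ≼[ ds ] j = Star (Step ds) i j

-- If some function is strictly increasing along the steps, then the
-- relation they generate is a decidable partial order.

step? : ∀ {n} (ds : Vec Direction n) i j → Dec (Step ds i j)
step? ds i j = map′
  (λ { (inj₁ (p , refl)) → ascend p ; (inj₂ (p , refl)) → descend p })
  (λ { (ascend p) → inj₁ (p , refl) ; (descend p) → inj₂ (p , refl) })
  ((lookup ds i ≟ᵈ up ×-dec j Fin.≟ next i) ⊎-dec
   (lookup ds j ≟ᵈ down ×-dec i Fin.≟ next j))

module _ {n} (ds : Vec Direction n) (φ : Fin n → ℕ)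
         (φ-step : ∀ {i j} → Step ds i j → φ i < φ j) where

  φ-mono : ∀ {i j} → i ≼[ ds ] j → φ i ≤ φ j
  φ-mono ε        = ℕ.≤-refl
  φ-mono (s ◅ ss) = ℕ.≤-trans (ℕ.<⇒≤ (φ-step s)) (φ-mono ss)

  ≼-antisym : ∀ {i j} → i ≼[ ds ] j → j ≼[ ds ] i → i ≡ j
  ≼-antisym ε        _  = refl
  ≼-antisym (s ◅ ss) ts = ⊥-elim
    (ℕ.<-irrefl refl (ℕ.<-≤-trans (φ-step s) (φ-mono (ss ◅◅ ts))))

  unsnoc : ∀ {i j} → i ≼[ ds ] j → i ≢ j →
           ∃[ k ] i ≼[ ds ] k × Step ds k j
  unsnoc ε i≢i = ⊥-elim (i≢i refl)
  unsnoc {i} {j} (_◅_ {j = k} s ss) _ with k Fin.≟ j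
  ... | yes refl = i , ε , s
  ... | no k≢j with unsnoc ss k≢j
  ...   | l , ts , t = l , s ◅ ts , t

  ≼-decAcc : ∀ i j → Acc _<_ (φ j) → Dec (i ≼[ ds ] j)
  ≼-decAcc i j (acc rs) with i Fin.≟ j
  ... | yes refl = yes ε
  ... | no i≢j with any? below?
    where
    below? : ∀ k → Dec (i ≼[ ds ] k × Step ds k j)
    below? k with step? ds k j
    ... | no ¬s = no λ (_ , s) → ¬s s
    ... | yes s with ≼-decAcc i k (rs (φ-step s))
    ...   | yes i≼k = yes (i≼k , s)
    ...   | no  i⋠k = no λ (i≼k , _) → i⋠k i≼k
  ...   | yes (k , i≼k , s) = yes (i≼k ◅◅ (s ◅ ε))
  ...   | no  ¬k            = no λ i≼j → ¬k (unsnoc i≼j i≢j)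

  ≼-isDecPartialOrder : IsDecPartialOrder _≡_ (λ i j → i ≼[ ds ] j)
  ≼-isDecPartialOrder = record
    { isPartialOrder = record
      { isPreorder = record
        { isEquivalence = isEquivalence
        ; reflexive     = λ { refl → ε }
        ; trans         = _◅◅_
        }
      ; antisym = ≼-antisym
      }
    ; _≟_  = Fin._≟_
    ; _≤?_ = λ i j → ≼-decAcc i j (<-wellFounded (φ j))
    }

-- Such a function exists when the first step goes up and the last one goes
-- down: count each earlier ascent with weight w and each later descent with
-- weight 1, where w exceeds the number of descents.

next-inject₁ : ∀ {n} (j : Fin n) → next (inject₁ j) ≡ suc j
next-inject₁ {n} j = Fin.toℕ-injective (trans (Fin.toℕ-fromℕ< _) (trans
  (m<n⇒m%n≡m (s≤s (subst (_< n) (sym (Fin.toℕ-inject₁ j)) (Fin.toℕ<n j))))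
  (cong suc (Fin.toℕ-inject₁ j))))

next-fromℕ : ∀ n → next (fromℕ n) ≡ zero
next-fromℕ n = Fin.toℕ-injective (trans (Fin.toℕ-fromℕ< _) (trans
  (cong (λ k → suc k % suc n) (Fin.toℕ-fromℕ n)) (n%n≡0 (suc n))))

descents : ∀ {n} → Vec Direction n → ℕ
descents []          = 0
descents (up   ∷ ds) = descents ds
descents (down ∷ ds) = suc (descents ds)

descents≤n : ∀ {n} (ds : Vec Direction n) → descents ds ≤ n
descents≤n []          = z≤n
descents≤n (up   ∷ ds) = ℕ.m≤n⇒m≤1+n (descents≤n ds)
descents≤n (down ∷ ds) = s≤s (descents≤n ds)

module _ (w : ℕ) where

  potential : ∀ {n} → Vec Direction n → Fin n → ℕ
  potential ds          zero    = descents ds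
  potential (up   ∷ ds) (suc i) = w + potential ds i
  potential (down ∷ ds) (suc i) = potential ds i

  potential-up : 0 < w → ∀ {n} (ds : Vec Direction (suc n)) j →
                 lookup ds (inject₁ j) ≡ up →
                 potential ds (inject₁ j) < potential ds (suc j)
  potential-up 0<w (up ∷ ds)   zero    _ = ℕ.m<n+m (descents ds) 0<w
  potential-up 0<w (up ∷ ds)   (suc j) p =
    ℕ.+-monoʳ-< w (potential-up 0<w ds j p)
  potential-up 0<w (down ∷ ds) (suc j) p = potential-up 0<w ds j p

  potential-down : ∀ {n} (ds : Vec Direction (suc n)) j →
                   lookup ds (inject₁ j) ≡ down →
                   potential ds (suc j) < potential ds (inject₁ j)
  potential-down (down ∷ ds) zero    _ = ℕ.n<1+n (descents ds)
  potential-down (up ∷ ds)   (suc j) p =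
    ℕ.+-monoʳ-< w (potential-down ds j p)
  potential-down (down ∷ ds) (suc j) p = potential-down ds j p

EndsWith : ∀ {n} → Direction → Vec Direction n → Set
EndsWith {n} d ds = ∀ i → suc (toℕ i) ≡ n → lookup ds i ≡ d

module _ {n} (ds : Vec Direction (suc n)) (ends : EndsWith down (up ∷ ds)) where

  potential-step : ∀ {i j} → Step (up ∷ ds) i j →
                   potential (2 + n) (up ∷ ds) i < potential (2 + n) (up ∷ ds) j
  potential-step (ascend {i} p) with view i
  ... | ‵inject₁ j rewrite next-inject₁ j =
    potential-up (2 + n) (s≤s z≤n) (up ∷ ds) j p
  ... | ‵fromℕ with trans (sym p)
                 (ends (fromℕ (suc n)) (cong suc (Fin.toℕ-fromℕ (suc n))))
  ...   | ()
  potential-step (descend {i} p) with view i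
  ... | ‵inject₁ j rewrite next-inject₁ j =
    potential-down (2 + n) (up ∷ ds) j p
  ... | ‵fromℕ rewrite next-fromℕ (suc n) =
    s≤s (ℕ.≤-trans (descents≤n ds) (ℕ.m≤m+n (suc n) _))

endsWith-++ : ∀ {m n d} (ds : Vec Direction m) {es : Vec Direction n} → 0 < n →
              EndsWith d es → EndsWith d (ds Vec.++ es)
endsWith-++ []                 0<n ends = ends
endsWith-++ {suc m} {suc n} (d ∷ ds) 0<n ends zero    p
  with trans (ℕ.suc-injective p) (ℕ.+-suc m n)
... | ()
endsWith-++ (d ∷ ds)           0<n ends (suc i) p =
  endsWith-++ ds 0<n ends i (ℕ.suc-injective p)

endsWith-replicate : ∀ n d → EndsWith d (replicate n d Vec.++ [])
endsWith-replicate (suc n) d zero    p = refl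
endsWith-replicate (suc n) d (suc i) p =
  endsWith-replicate n d i (ℕ.suc-injective p)

endsWith-steps : ∀ cs → All (0 <_) cs → 2 ∣ length cs →
                 EndsWith down (steps up cs)
endsWith-steps (a ∷ []) _ 2∣1 with ∣⇒≤ 2∣1
... | s≤s ()
endsWith-steps (a ∷ b ∷ []) (_ ∷ 0<b ∷ []) _ =
  endsWith-++ (replicate a up) (ℕ.<-≤-trans 0<b (ℕ.m≤m+n b 0))
    (endsWith-replicate b down)
endsWith-steps (a ∷ b ∷ c ∷ cs) (_ ∷ 0<b ∷ 0<c ∷ 0<cs) 2∣l =
  endsWith-++ (replicate a up) (ℕ.<-≤-trans 0<b (ℕ.m≤m+n b _))
    (endsWith-++ (replicate b down) (ℕ.<-≤-trans 0<c (ℕ.m≤m+n c _))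
      (endsWith-steps (c ∷ cs) (0<c ∷ 0<cs) (∣m+n∣m⇒∣n 2∣l ∣-refl)))

steps-isDecPartialOrder : ∀ cs → All (0 <_) cs → 2 ∣ length cs →
  IsDecPartialOrder _≡_ (λ i j → i ≼[ steps up cs ] j)
steps-isDecPartialOrder [] _ _ = ≼-isDecPartialOrder [] (λ ()) λ { {()} }
steps-isDecPartialOrder (a ∷ []) _ 2∣1 with ∣⇒≤ 2∣1
... | s≤s ()
steps-isDecPartialOrder cs@(suc a ∷ suc b ∷ cs′) 0<cs 2∣l =
  go (replicate a up Vec.++ steps down (suc b ∷ cs′))
     (ℕ.<-≤-trans (s≤s z≤n) (ℕ.m≤n+m (suc (b + sum cs′)) a))
     (endsWith-steps cs 0<cs 2∣l)
  where
  go : ∀ {n} (ds : Vec Direction n) → 0 < n → EndsWith down (up ∷ ds) →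
       IsDecPartialOrder _≡_ (λ i j → i ≼[ up ∷ ds ] j)
  go {suc n} ds _ ends =
    ≼-isDecPartialOrder (up ∷ ds) (potential (2 + n) (up ∷ ds))
      (potential-step ds ends)
steps-isDecPartialOrder (suc a ∷ zero ∷ cs) (_ ∷ () ∷ _) _
steps-isDecPartialOrder (zero ∷ cs) (() ∷ _) _

circularFence : (c : Composition) → 2 ∣ length (Composition.parts c) →
                FinPoset (Composition.size c)
circularFence c even = record
  { _≼_               = λ i j → i ≼[ steps up parts ] j
  ; isDecPartialOrder = steps-isDecPartialOrder parts positive even
  }
  where open Composition c

{-# OPTIONS --safe #-}

-- The lower ideals of a circular fence are counted by the trace R(w) of a
-- product of 2 × 2 matrices U and D over ℕ[q], one for each step. Since U - 1
-- has rank one, for a word X = D…D the trace R(U^a X) equals R(X) + [a] Δ(X),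
-- where Δ(X) = tr ((U - 1) X) satisfies Δ(Y U^a Z) = Δ(Y Z) + [a] Δ(Y) Δ(Z).
-- All R(w) are palindromic of degree |w|, so that their unimodality means
-- f_j ≤ f_i for j ≤ i and i + j ≤ |w|; call this "f rises up to |w|".
--
-- R(U^a X) rises up to |X| + a if R(X) and Δ(X) rise up to |X|. Conversely, the
-- palindromes R(X) and R(U X) = R(X) + Δ(X), with centres half a unit apart,
-- improve bounds on Δ(X): if R(U X) is unimodal and Δ(X) rises up to |X| - 1, then
-- it rises up to |X|; if also R(X) is unimodal, then it rises up to |X| + 1. This
-- gains the unit that each use of the product formula for Δ loses, and the two
-- statements are proved together by induction on the number of runs. The
-- exceptional cycles (a,1,a,1) make the induction irregular up to six runs.

module Submission where

open import Defs
open import Data.Nat.Base using (_<_)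
open import Data.Nat.Divisibility using (_∣_)
open import Data.List.Base using ([]; _∷_; length)
open import Data.Product using (∃-syntax; _×_)
open import Data.Sum using (_⊎_)
open import Relation.Nullary using (¬_)
open import Relation.Binary.PropositionalEquality using (_≡_)

open import Algebra.Bundles using (CommutativeSemiring)
open import Data.List.Base using (List; _++_; replicate; reverse; map; filter)
open import Data.List.Properties
  using (++-assoc; ++-identityʳ; unfold-reverse; reverse-++; map-++;
         map-replicate; length-++; length-replicate)
open import Data.Nat.Base as ℕ using (ℕ; zero; suc)
import Data.Nat.Properties as ℕ
open import Data.Product using (_,_; proj₁; proj₂)
open import Function.Base using (_∘_)
import Relation.Binary.PropositionalEquality as ≡

-- The obstacle is a gap: `δ c` is `q + ... + q^c + q^(c+2)`, which for `c > 0` rises up to `c + 1`,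
-- the length of its run, and no further. In the product formula for a word Y U^a Z, moreover, the
-- term Δ(Y Z) belongs to a word shorter by the whole run U^a. Runs of steps up are therefore grown
-- one step at a time, and the bound is raised after each step. Each raise presupposes that R of the
-- current word X is unimodal. As a cycle, X joins its first and last runs of steps down, and the
-- result may be exceptional; with at least two steps down at its end, it can then only have the
-- form (1,a,1,a). What cannot be reached from one side is reached through a symmetry: rotating a
-- cycle, reading it backwards, which exchanges steps up and down, or reversing a chain. Explicit
-- computations are confined to base cases and to a few chains blocked from both sides.

Word : Set
Word = List Direction

Block : Set
Block = ℕ × ℕ

-- The block (a , c) stands for a + 1 steps up followed by c + 1 steps down, so
-- that all runs are nonempty.
blockWord : List Block → Word
blockWord []            = []
blockWord ((a , c) ∷ L) = replicate (suc a) up ++ replicate (suc c) down ++ blockWord L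

replicate-+ : ∀ {A : Set} m n (x : A) → replicate m x ++ replicate n x ≡ replicate (m ℕ.+ n) x
replicate-+ zero    n x = ≡.refl
replicate-+ (suc m) n x = ≡.cong (x ∷_) (replicate-+ m n x)

reverse-replicate : ∀ {A : Set} n (x : A) → reverse (replicate n x) ≡ replicate n x
reverse-replicate zero    x = ≡.refl
reverse-replicate (suc n) x = ≡.trans (unfold-reverse x (replicate n x))
  (≡.trans (≡.cong (_++ x ∷ []) (reverse-replicate n x))
    (≡.trans (replicate-+ n 1 x) (≡.cong (λ m → replicate m x) (ℕ.+-comm n 1))))

-- A run of `f + 1` steps down in front of the blocks becomes, around the cycle, part of the last
-- run.
merge : ℕ → Block → List Block → List Block
merge f (a , g) []      = (a , suc (g ℕ.+ f)) ∷ []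
merge f b       (b′ ∷ L) = b ∷ merge f b′ L

-- This is the same cycle traversed the other way, where a step up is met as a step down. It lets
-- statements about runs of steps up be applied to runs of steps down.
dual : List Block → List Block
dual []            = []
dual ((a , c) ∷ L) = dual L ++ (c , a) ∷ []

blockWord-++ : ∀ L L′ → blockWord (L ++ L′) ≡ blockWord L ++ blockWord L′
blockWord-++ []            L′ = ≡.refl
blockWord-++ ((a , c) ∷ L) L′ = ≡.trans
  (≡.cong (λ w → replicate (suc a) up ++ replicate (suc c) down ++ w) (blockWord-++ L L′))
  (≡.trans (≡.cong (replicate (suc a) up ++_)
      (≡.sym (++-assoc (replicate (suc c) down) (blockWord L) (blockWord L′))))
    (≡.sym (++-assoc (replicate (suc a) up) _ (blockWord L′))))

blockWord-merge : ∀ f b L →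
  blockWord (merge f b L) ≡ blockWord (b ∷ L) ++ replicate (suc f) down
blockWord-merge f (a , g) [] = ≡.trans
  (≡.cong (replicate (suc a) up ++_) (≡.trans
    (≡.cong (_++ []) (≡.trans (≡.cong (λ n → replicate (suc n) down) (≡.sym (ℕ.+-suc g f)))
      (≡.sym (replicate-+ (suc g) (suc f) down))))
    (≡.trans (++-identityʳ _) (≡.cong (_++ replicate (suc f) down)
      (≡.sym (++-identityʳ (replicate (suc g) down)))))))
  (≡.sym (++-assoc (replicate (suc a) up) (replicate (suc g) down ++ []) (replicate (suc f) down)))
blockWord-merge f (a , g) (b ∷ L) = ≡.trans
  (≡.cong (λ w → replicate (suc a) up ++ replicate (suc g) down ++ w) (blockWord-merge f b L))
  (≡.trans (≡.cong (replicate (suc a) up ++_)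
      (≡.sym (++-assoc (replicate (suc g) down) (blockWord (b ∷ L)) _)))
    (≡.sym (++-assoc (replicate (suc a) up) _ _)))

transposed : Word → Word
transposed w = reverse (map opposite w)

transposed-++ : ∀ u v → transposed (u ++ v) ≡ transposed v ++ transposed u
transposed-++ u v = ≡.trans (≡.cong reverse (map-++ opposite u v))
  (reverse-++ (map opposite u) (map opposite v))

transposed-replicate : ∀ n d → transposed (replicate n d) ≡ replicate n (opposite d)
transposed-replicate n d = ≡.trans (≡.cong reverse (map-replicate opposite n d))
  (reverse-replicate n (opposite d))

blockWord-dual : ∀ L → blockWord (dual L) ≡ transposed (blockWord L)
blockWord-dual []            = ≡.refl
blockWord-dual ((a , c) ∷ L) = ≡.trans (blockWord-++ (dual L) ((c , a) ∷ []))
  (≡.trans (≡.cong₂ _++_ (blockWord-dual L) (≡.trans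
      (≡.cong (replicate (suc c) up ++_) (++-identityʳ (replicate (suc a) down)))
      (≡.cong₂ _++_ (≡.sym (transposed-replicate (suc c) down))
        (≡.sym (transposed-replicate (suc a) up)))))
  (≡.trans (≡.sym (++-assoc (transposed (blockWord L)) _ _))
  (≡.trans (≡.cong (_++ transposed (replicate (suc a) up))
      (≡.sym (transposed-++ (replicate (suc c) down) (blockWord L))))
    (≡.sym (transposed-++ (replicate (suc a) up) _)))))

-- Transfer matrices over a commutative semiring

module Transfer {c ℓ} (S : CommutativeSemiring c ℓ)
                (q : CommutativeSemiring.Carrier S) where

  open CommutativeSemiring S
  open import Algebra.Solver.Ring.NaturalCoefficients.Default S
    using (solve; _:+_; _:*_; _:=_; con)
  open import Relation.Binary.Reasoning.Setoid setoid

  infix 9 q^_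

  [_]q : ℕ → Carrier
  [ zero ]q  = 0#
  [ suc n ]q = 1# + q * [ n ]q

  q^_ : ℕ → Carrier
  q^ zero  = 1#
  q^ suc n = q * q^ n

  q^-+ : ∀ m n → q^ (m ℕ.+ n) ≈ q^ m * q^ n
  q^-+ zero    n = sym (*-identityˡ (q^ n))
  q^-+ (suc m) n = trans (*-congˡ (q^-+ m n)) (sym (*-assoc q (q^ m) (q^ n)))

  []-+ : ∀ m n → [ m ℕ.+ n ]q ≈ [ m ]q + q^ m * [ n ]q
  []-+ zero    n = solve 1 (λ x → x := con 0 :+ con 1 :* x) refl [ n ]q
  []-+ (suc m) n = trans (+-congˡ (*-congˡ ([]-+ m n)))
    (solve 4 (λ q x y z → con 1 :+ q :* (x :+ y :* z) :=
                          con 1 :+ q :* x :+ q :* y :* z)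
      refl q [ m ]q (q^ m) [ n ]q)

  []-suc : ∀ n → [ suc n ]q ≈ [ n ]q + q^ n
  []-suc zero    = solve 1 (λ q → con 1 :+ q :* con 0 := con 0 :+ con 1) refl q
  []-suc (suc n) = trans (+-congˡ (*-congˡ ([]-suc n)))
    (solve 3 (λ q x y → con 1 :+ q :* (x :+ y) := con 1 :+ q :* x :+ q :* y)
      refl q [ n ]q (q^ n))

  record Matrix : Set c where
    constructor mat
    field m₀₀ m₀₁ m₁₀ m₁₁ : Carrier
  open Matrix public

  record _≈ᴹ_ (A B : Matrix) : Set ℓ where
    constructor mat≈
    field
      ≈₀₀ : m₀₀ A ≈ m₀₀ B
      ≈₀₁ : m₀₁ A ≈ m₀₁ B
      ≈₁₀ : m₁₀ A ≈ m₁₀ B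
      ≈₁₁ : m₁₁ A ≈ m₁₁ B
  open _≈ᴹ_ public

  infix  4 _≈ᴹ_
  infixr 7 _⊗_

  ≈ᴹ-refl : ∀ {A} → A ≈ᴹ A
  ≈ᴹ-refl = mat≈ refl refl refl refl

  ≈ᴹ-sym : ∀ {A B} → A ≈ᴹ B → B ≈ᴹ A
  ≈ᴹ-sym (mat≈ p r s t) = mat≈ (sym p) (sym r) (sym s) (sym t)

  ≈ᴹ-trans : ∀ {A B C} → A ≈ᴹ B → B ≈ᴹ C → A ≈ᴹ C
  ≈ᴹ-trans (mat≈ p r s t) (mat≈ p′ r′ s′ t′) =
    mat≈ (trans p p′) (trans r r′) (trans s s′) (trans t t′)

  _⊗_ : Matrix → Matrix → Matrix
  mat a b c d ⊗ mat e f g h =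
    mat (a * e + b * g) (a * f + b * h) (c * e + d * g) (c * f + d * h)

  ⊗-cong : ∀ {A A′ B B′} → A ≈ᴹ A′ → B ≈ᴹ B′ → A ⊗ B ≈ᴹ A′ ⊗ B′
  ⊗-cong (mat≈ p r s t) (mat≈ p′ r′ s′ t′) = mat≈
    (+-cong (*-cong p p′) (*-cong r s′)) (+-cong (*-cong p r′) (*-cong r t′))
    (+-cong (*-cong s p′) (*-cong t s′)) (+-cong (*-cong s r′) (*-cong t t′))

  ⊗-assoc : ∀ A B C → (A ⊗ B) ⊗ C ≈ᴹ A ⊗ (B ⊗ C)
  ⊗-assoc (mat a b c d) (mat e f g h) (mat i j k l) =
    mat≈ (assoc a b i k) (assoc a b j l) (assoc c d i k) (assoc c d j l)
    where
    assoc : ∀ a b i k → (a * e + b * g) * i + (a * f + b * h) * k ≈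
                        a * (e * i + f * k) + b * (g * i + h * k)
    assoc = λ a b i k → solve 8 (λ a b i k e f g h →
      (a :* e :+ b :* g) :* i :+ (a :* f :+ b :* h) :* k :=
      a :* (e :* i :+ f :* k) :+ b :* (g :* i :+ h :* k)) refl a b i k e f g h

  Id : Matrix
  Id = mat 1# 0# 0# 1#

  ⊗-identityˡ : ∀ A → Id ⊗ A ≈ᴹ A
  ⊗-identityˡ (mat a b c d) = mat≈ (top a c) (top b d) (bot a c) (bot b d)
    where
    top = λ a c → solve 2 (λ a c → con 1 :* a :+ con 0 :* c := a) refl a c
    bot = λ a c → solve 2 (λ a c → con 0 :* a :+ con 1 :* c := c) refl a c

  ⊗-identityʳ : ∀ A → A ⊗ Id ≈ᴹ A
  ⊗-identityʳ (mat a b c d) = mat≈ (left a b) (right a b) (left c d) (right c d)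
    where
    left  = λ a b → solve 2 (λ a b → a :* con 1 :+ b :* con 0 := a) refl a b
    right = λ a b → solve 2 (λ a b → a :* con 0 :+ b :* con 1 := b) refl a b

  trace : Matrix → Carrier
  trace A = m₀₀ A + m₁₁ A

  trace-cong : ∀ {A B} → A ≈ᴹ B → trace A ≈ trace B
  trace-cong A≈B = +-cong (≈₀₀ A≈B) (≈₁₁ A≈B)

  trace-comm : ∀ A B → trace (A ⊗ B) ≈ trace (B ⊗ A)
  trace-comm (mat a b c d) (mat e f g h) = solve 8 (λ a b c d e f g h →
    (a :* e :+ b :* g) :+ (c :* f :+ d :* h) :=
    (e :* a :+ f :* c) :+ (g :* b :+ h :* d)) refl a b c d e f g h

  -- The entry at (x , y) of the matrix of a word sums q^(number of ones) over the
  -- bit strings that start with x, are followed by y and satisfy the constraints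
  -- of the word, a step up forbidding 01 and a step down forbidding 10.

  letter : Direction → Matrix → Matrix
  letter up   (mat a b c d) = mat a b (q * (a + c)) (q * (b + d))
  letter down (mat a b c d) = mat (a + c) (b + d) (q * c) (q * d)

  letter-cong : ∀ d {A B} → A ≈ᴹ B → letter d A ≈ᴹ letter d B
  letter-cong up   (mat≈ p r s t) =
    mat≈ p r (*-congˡ (+-cong p s)) (*-congˡ (+-cong r t))
  letter-cong down (mat≈ p r s t) =
    mat≈ (+-cong p s) (+-cong r t) (*-congˡ s) (*-congˡ t)

  letter-⊗ : ∀ d A B → letter d (A ⊗ B) ≈ᴹ letter d A ⊗ B
  letter-⊗ up (mat a b c d) (mat e f g h) = mat≈ refl refl (row e g) (row f h)
    where
    row = λ e g → solve 7 (λ q a b c d e g →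
      q :* ((a :* e :+ b :* g) :+ (c :* e :+ d :* g)) :=
      q :* (a :+ c) :* e :+ q :* (b :+ d) :* g) refl q a b c d e g
  letter-⊗ down (mat a b c d) (mat e f g h) = mat≈ (row e g) (row f h) (row′ e g) (row′ f h)
    where
    row = λ e g → solve 6 (λ a b c d e g →
      (a :* e :+ b :* g) :+ (c :* e :+ d :* g) :=
      (a :+ c) :* e :+ (b :+ d) :* g) refl a b c d e g
    row′ = λ e g → solve 5 (λ q c d e g →
      q :* (c :* e :+ d :* g) := q :* c :* e :+ q :* d :* g) refl q c d e g

  matrix : Word → Matrix
  matrix []      = Id
  matrix (d ∷ w) = letter d (matrix w)

  matrix-++ : ∀ u v → matrix (u ++ v) ≈ᴹ matrix u ⊗ matrix v
  matrix-++ []      v = ≈ᴹ-sym (⊗-identityˡ (matrix v))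
  matrix-++ (d ∷ u) v =
    ≈ᴹ-trans (letter-cong d (matrix-++ u v)) (letter-⊗ d (matrix u) (matrix v))

  R : Word → Carrier
  R w = trace (matrix w)

  R-rotate : ∀ u v → R (u ++ v) ≈ R (v ++ u)
  R-rotate u v = begin
    R (u ++ v)                    ≈⟨ trace-cong (matrix-++ u v) ⟩
    trace (matrix u ⊗ matrix v)   ≈⟨ trace-comm (matrix u) (matrix v) ⟩
    trace (matrix v ⊗ matrix u)   ≈⟨ trace-cong (matrix-++ v u) ⟨
    R (v ++ u)                    ∎

  matrix-up : ∀ n → matrix (replicate n up) ≈ᴹ mat 1# 0# (q * [ n ]q) (q^ n)
  matrix-up zero    = mat≈ refl refl (sym (zeroʳ q)) refl
  matrix-up (suc n) = ≈ᴹ-trans (letter-cong up (matrix-up n))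
    (mat≈ refl refl refl (*-congˡ (+-identityˡ (q^ n))))

  matrix-down : ∀ n → matrix (replicate n down) ≈ᴹ mat 1# [ n ]q 0# (q^ n)
  matrix-down zero    = ≈ᴹ-refl
  matrix-down (suc n) = ≈ᴹ-trans (letter-cong down (matrix-down n))
    (mat≈ (+-identityʳ 1#) (sym ([]-suc n)) (zeroʳ q) refl)

  -- δ c is tr ((U - 1) D^(c+1)), that is q [c+1] + (q - 1) q^(c+1), written
  -- without subtraction.
  δ : ℕ → Carrier
  δ c = q * [ c ]q + q * (q * q^ c)

  -- Multiplying the row `(q , δ c)` by D^(d+1) only lengthens its run: the right-hand side is the
  -- second entry of the product.
  δ-+ : ∀ c d → δ (suc (c ℕ.+ d)) ≈ q * [ suc d ]q + q^ suc d * δ c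
  δ-+ c d = begin
    δ (suc (c ℕ.+ d))
      ≡⟨ ≡.cong (δ ∘ suc) (ℕ.+-comm c d) ⟩
    q * [ suc d ℕ.+ c ]q + q * (q * q^ (suc d ℕ.+ c))
      ≈⟨ +-cong (*-congˡ ([]-+ (suc d) c)) (*-congˡ (*-congˡ (q^-+ (suc d) c))) ⟩
    q * ([ suc d ]q + q^ suc d * [ c ]q) + q * (q * (q^ suc d * q^ c))
      ≈⟨ solve 5 (λ q x y z t →
           q :* (x :+ y :* z) :+ q :* (q :* (y :* t)) :=
           q :* x :+ y :* (q :* z :+ q :* (q :* t)))
         refl q [ suc d ]q (q^ suc d) [ c ]q (q^ c) ⟩
    q * [ suc d ]q + q^ suc d * δ c ∎

  -- This is q^n = 1 + (q - 1) [n], combined with the definition of δ.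
  power-relation : ∀ n g → q * [ n ]q * [ suc g ]q + q^ n * q^ suc g ≈
                           q^ suc g + [ n ]q * δ g
  power-relation zero    g = solve 4 (λ q x y z →
    q :* con 0 :* x :+ con 1 :* y := y :+ con 0 :* z) refl q [ suc g ]q (q^ suc g) (δ g)
  power-relation (suc n) g = begin
    q * [ suc n ]q * G + q^ suc n * P
      ≈⟨ +-congʳ (*-congʳ (*-congˡ ([]-suc n))) ⟩
    q * ([ n ]q + q^ n) * G + q * q^ n * P
      ≈⟨ +-congʳ (*-congˡ ([]-suc g)) ⟩
    q * ([ n ]q + q^ n) * ([ g ]q + q^ g) + q * q^ n * P
      ≈⟨ solve 5 (λ q x y z t →
           q :* (x :+ y) :* (z :+ t) :+ q :* y :* (q :* t) :=
           (q :* x :* (z :+ t) :+ y :* (q :* t)) :+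
             y :* (q :* z :+ q :* (q :* t)))
         refl q [ n ]q (q^ n) [ g ]q (q^ g) ⟩
    (q * [ n ]q * ([ g ]q + q^ g) + q^ n * P) + q^ n * δ g
      ≈⟨ +-congʳ (+-congʳ (*-congˡ ([]-suc g))) ⟨
    (q * [ n ]q * G + q^ n * P) + q^ n * δ g
      ≈⟨ +-congʳ (power-relation n g) ⟩
    (P + [ n ]q * δ g) + q^ n * δ g
      ≈⟨ solve 4 (λ p x d y → (p :+ x :* d) :+ y :* d := p :+ (x :+ y) :* d)
         refl P [ n ]q (δ g) (q^ n) ⟩
    P + ([ n ]q + q^ n) * δ g
      ≈⟨ +-congˡ (*-congʳ ([]-suc n)) ⟨
    P + [ suc n ]q * δ g ∎
    where
    G = [ suc g ]q
    P = q^ suc g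

  -- The second entry of the row vector (x , y) Z. The row (q , δ g) is the second
  -- row of (U - 1) D^(g+1), its only nonzero one.
  form : Carrier → Carrier → Matrix → Carrier
  form x y Z = x * m₀₁ Z + y * m₁₁ Z

  form-cong : ∀ {x x′ y y′ A B} → x ≈ x′ → y ≈ y′ → A ≈ᴹ B → form x y A ≈ form x′ y′ B
  form-cong p r A≈B = +-cong (*-cong p (≈₀₁ A≈B)) (*-cong r (≈₁₁ A≈B))

  ups downs : ℕ → Matrix
  ups   n = matrix (replicate n up)
  downs n = matrix (replicate n down)

  -- Since U^n = 1 + [n] (U - 1) and U - 1 has only its second row, the row `(x , y)` enters the
  -- correction term through `y` alone. This is the rank-one factorization behind the product
  -- formula.
  form-peel : ∀ x y n g Z → form x y (ups n ⊗ downs (suc g) ⊗ Z) ≈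
                            form x y (downs (suc g) ⊗ Z) + [ n ]q * y * form q (δ g) Z
  form-peel x y n g Z@(mat a b c d) = begin
    form x y (ups n ⊗ downs (suc g) ⊗ Z)
      ≈⟨ form-cong {y = y} refl refl
           (⊗-cong (matrix-up n) (⊗-cong (matrix-down (suc g)) (≈ᴹ-refl {Z}))) ⟩
    form x y (mat 1# 0# (q * N) Q ⊗ mat 1# G 0# P ⊗ Z)
      ≈⟨ solve 9 (λ x y q N Q G P b d →
           x :* (con 1 :* (con 1 :* b :+ G :* d) :+ con 0 :* (con 0 :* b :+ P :* d)) :+
           y :* (q :* N :* (con 1 :* b :+ G :* d) :+ Q :* (con 0 :* b :+ P :* d)) :=
           x :* (b :+ G :* d) :+ y :* (q :* N :* b :+ (q :* N :* G :+ Q :* P) :* d))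
         refl x y q N Q G P b d ⟩
    x * (b + G * d) + y * (q * N * b + (q * N * G + Q * P) * d)
      ≈⟨ +-congˡ (*-congˡ (+-congˡ (*-congʳ (power-relation n g)))) ⟩
    x * (b + G * d) + y * (q * N * b + (P + N * δ g) * d)
      ≈⟨ solve 9 (λ x y q N G P b d e →
           x :* (b :+ G :* d) :+ y :* (q :* N :* b :+ (P :+ N :* e) :* d) :=
           x :* (con 1 :* b :+ G :* d) :+ y :* (con 0 :* b :+ P :* d) :+
           N :* y :* (q :* b :+ e :* d))
         refl x y q N G P b d (δ g) ⟩
    form x y (mat 1# G 0# P ⊗ Z) + N * y * form q (δ g) Z
      ≈⟨ +-congʳ (form-cong {y = y} refl refl (⊗-cong (matrix-down (suc g)) (≈ᴹ-refl {Z}))) ⟨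
    form x y (downs (suc g) ⊗ Z) + N * y * form q (δ g) Z ∎
    where
    N = [ n ]q
    Q = q^ n
    G = [ suc g ]q
    P = q^ suc g

  form-downs : ∀ f g Z → form q (δ f) (downs (suc g) ⊗ Z) ≈ form q (δ (suc (f ℕ.+ g))) Z
  form-downs f g Z@(mat a b c d) = begin
    form q (δ f) (downs (suc g) ⊗ Z)
      ≈⟨ form-cong {q} {q} {δ f} refl refl (⊗-cong (matrix-down (suc g)) (≈ᴹ-refl {Z})) ⟩
    form q (δ f) (mat 1# [ suc g ]q 0# (q^ suc g) ⊗ Z)
      ≈⟨ solve 6 (λ q e G P b d →
           q :* (con 1 :* b :+ G :* d) :+ e :* (con 0 :* b :+ P :* d) :=
           q :* b :+ (q :* G :+ P :* e) :* d)
         refl q (δ f) [ suc g ]q (q^ suc g) b d ⟩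
    q * b + (q * [ suc g ]q + q^ suc g * δ f) * d
      ≈⟨ +-congˡ (*-congʳ (δ-+ f g)) ⟨
    form q (δ (suc (f ℕ.+ g))) Z ∎

  trace-peel : ∀ n g Z → trace (ups n ⊗ downs (suc g) ⊗ Z) ≈
                         trace (downs (suc g) ⊗ Z) + [ n ]q * form q (δ g) Z
  trace-peel n g Z = begin
    trace (ups n ⊗ Y)
      ≈⟨ +-cong (m₀₀-ups Y) (sym (form-01 (ups n ⊗ Y))) ⟩
    m₀₀ Y + form 0# 1# (ups n ⊗ Y)
      ≈⟨ +-congˡ (form-peel 0# 1# n g Z) ⟩
    m₀₀ Y + (form 0# 1# Y + [ n ]q * 1# * F)
      ≈⟨ +-congˡ (+-cong (form-01 Y) (*-congʳ (*-identityʳ [ n ]q))) ⟩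
    m₀₀ Y + (m₁₁ Y + [ n ]q * F)
      ≈⟨ +-assoc _ _ _ ⟨
    trace Y + [ n ]q * F ∎
    where
    Y = downs (suc g) ⊗ Z
    F = form q (δ g) Z
    form-01 : ∀ A → form 0# 1# A ≈ m₁₁ A
    form-01 A = solve 2 (λ x y → con 0 :* x :+ con 1 :* y := y) refl (m₀₁ A) (m₁₁ A)
    m₀₀-ups : ∀ A → m₀₀ (ups n ⊗ A) ≈ m₀₀ A
    m₀₀-ups A = trans (≈₀₀ (⊗-cong (matrix-up n) (≈ᴹ-refl {A})))
      (solve 2 (λ x y → con 1 :* x :+ con 0 :* y := x) refl (m₀₀ A) (m₁₀ A))

  -- This is tr ((U - 1) D^(f+1) X) for the word X of the list, given by the recursion that the
  -- product formula yields when the first run of steps up is removed; `Δ-form` connects it with the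
  -- matrices.
  Δ : ℕ → List Block → Carrier
  Δ f []            = δ f
  Δ f ((a , g) ∷ L) = Δ (suc (f ℕ.+ g)) L + [ suc a ]q * δ f * Δ g L

  blocks : List Block → Matrix
  blocks L = matrix (blockWord L)

  blocks-∷ : ∀ a g L → blocks ((a , g) ∷ L) ≈ᴹ ups (suc a) ⊗ downs (suc g) ⊗ blocks L
  blocks-∷ a g L = ≈ᴹ-trans
    (matrix-++ (replicate (suc a) up) (replicate (suc g) down ++ blockWord L))
    (⊗-cong (≈ᴹ-refl {ups (suc a)}) (matrix-++ (replicate (suc g) down) (blockWord L)))


  -- The free factor `Z` on the right is the identity for `Δ` itself and a run of steps down in the
  -- reversal argument.
  peel : ∀ f a g L Z →
    form q (δ f) (blocks ((a , g) ∷ L) ⊗ Z) ≈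
    form q (δ (suc (f ℕ.+ g))) (blocks L ⊗ Z) +
      [ suc a ]q * δ f * form q (δ g) (blocks L ⊗ Z)
  peel f a g L Z = begin
    form q (δ f) (blocks ((a , g) ∷ L) ⊗ Z)
      ≈⟨ form-cong {y = δ f} refl refl
           (≈ᴹ-trans (⊗-cong (blocks-∷ a g L) (≈ᴹ-refl {Z}))
           (≈ᴹ-trans (⊗-assoc (ups (suc a)) _ Z)
             (⊗-cong (≈ᴹ-refl {ups (suc a)}) (⊗-assoc (downs (suc g)) (blocks L) Z)))) ⟩
    form q (δ f) (ups (suc a) ⊗ downs (suc g) ⊗ (blocks L ⊗ Z))
      ≈⟨ form-peel q (δ f) (suc a) g (blocks L ⊗ Z) ⟩
    form q (δ f) (downs (suc g) ⊗ (blocks L ⊗ Z)) +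
      [ suc a ]q * δ f * form q (δ g) (blocks L ⊗ Z)
      ≈⟨ +-congʳ (form-downs f g (blocks L ⊗ Z)) ⟩
    form q (δ (suc (f ℕ.+ g))) (blocks L ⊗ Z) +
      [ suc a ]q * δ f * form q (δ g) (blocks L ⊗ Z) ∎

  form-Id : ∀ f → form q (δ f) Id ≈ δ f
  form-Id f = solve 2 (λ q x → q :* con 0 :+ x :* con 1 := x) refl q (δ f)

  Δ-form : ∀ f L → form q (δ f) (blocks L ⊗ Id) ≈ Δ f L
  Δ-form f []            = trans (form-cong {q} {q} {δ f} refl refl (⊗-identityˡ Id)) (form-Id f)
  Δ-form f ((a , g) ∷ L) = trans (peel f a g L Id)
    (+-cong (Δ-form (suc (f ℕ.+ g)) L) (*-congˡ (Δ-form g L)))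

  chainWord : ℕ → List Block → Word
  chainWord f L = replicate (suc f) down ++ blockWord L

  R-peel : ∀ n f L → R (replicate n up ++ chainWord f L) ≈
                     R (chainWord f L) + [ n ]q * Δ f L
  R-peel n f L = begin
    R (replicate n up ++ chainWord f L)
      ≈⟨ trace-cong (≈ᴹ-trans (matrix-++ (replicate n up) (chainWord f L))
           (⊗-cong (≈ᴹ-refl {ups n}) chain)) ⟩
    trace (ups n ⊗ downs (suc f) ⊗ (blocks L ⊗ Id))
      ≈⟨ trace-peel n f (blocks L ⊗ Id) ⟩
    trace (downs (suc f) ⊗ (blocks L ⊗ Id)) + [ n ]q * form q (δ f) (blocks L ⊗ Id)
      ≈⟨ +-cong (sym (trace-cong chain)) (*-congˡ (Δ-form f L)) ⟩
    R (chainWord f L) + [ n ]q * Δ f L ∎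
    where
    chain : matrix (chainWord f L) ≈ᴹ downs (suc f) ⊗ (blocks L ⊗ Id)
    chain = ≈ᴹ-trans (matrix-++ (replicate (suc f) down) (blockWord L))
      (⊗-cong (≈ᴹ-refl {downs (suc f)}) (≈ᴹ-sym (⊗-identityʳ (blocks L))))

  downs-+ : ∀ m n → downs m ⊗ downs n ≈ᴹ downs (m ℕ.+ n)
  downs-+ m n = ≡.subst (λ w → downs m ⊗ downs n ≈ᴹ matrix w) (replicate-+ m n down)
    (≈ᴹ-sym (matrix-++ (replicate m down) (replicate n down)))

  -- Invariance under reversal of words

  rblocks : List Block → Matrix
  rblocks L = matrix (reverse (blockWord L))

  rblocks-∷ : ∀ a g L → rblocks ((a , g) ∷ L) ≈ᴹ (rblocks L ⊗ downs (suc g)) ⊗ ups (suc a)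
  rblocks-∷ a g L = ≡.subst (λ w → matrix w ≈ᴹ (rblocks L ⊗ downs (suc g)) ⊗ ups (suc a))
    (≡.sym eq)
    (≈ᴹ-trans (matrix-++ (reverse (blockWord L) ++ replicate (suc g) down) (replicate (suc a) up))
      (⊗-cong (matrix-++ (reverse (blockWord L)) (replicate (suc g) down)) (≈ᴹ-refl {ups (suc a)})))
    where
    eq : reverse (blockWord ((a , g) ∷ L)) ≡
         (reverse (blockWord L) ++ replicate (suc g) down) ++ replicate (suc a) up
    eq = ≡.trans
      (reverse-++ (replicate (suc a) up) (replicate (suc g) down ++ blockWord L))
      (≡.cong₂ _++_ (≡.trans (reverse-++ (replicate (suc g) down) (blockWord L))
          (≡.cong (reverse (blockWord L) ++_) (reverse-replicate (suc g) down)))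
        (reverse-replicate (suc a) up))

  form-⊗ : ∀ x y A Z → form x y (A ⊗ Z) ≈ form (x * m₀₀ A + y * m₁₀ A) (form x y A) Z
  form-⊗ x y (mat a b c d) (mat _ e _ h) = solve 8 (λ x y a b c d e h →
    x :* (a :* e :+ b :* h) :+ y :* (c :* e :+ d :* h) :=
    (x :* a :+ y :* c) :* e :+ (x :* b :+ y :* d) :* h) refl x y a b c d e h

  -- The first run of steps up in `L` is the last one in the reversed word. Removing it on both
  -- sides leaves terms of the same shape, to which the induction applies with other end runs.
  Δ-reverse : ∀ L f g → form q (δ g) (blocks L ⊗ downs (suc f)) ≈
                        form q (δ f) (rblocks L ⊗ downs (suc g))
  Δ-reverse [] f g = trans (ends g f)
    (trans (reflexive (≡.cong (δ ∘ suc) (ℕ.+-comm g f))) (sym (ends f g)))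
    where
    ends : ∀ g f → form q (δ g) (Id ⊗ downs (suc f)) ≈ δ (suc (g ℕ.+ f))
    ends g f = trans (form-cong {q} {q} {δ g} refl refl
        (≈ᴹ-trans (⊗-identityˡ (downs (suc f))) (≈ᴹ-sym (⊗-identityʳ (downs (suc f))))))
      (trans (form-downs g f Id) (form-Id (suc (g ℕ.+ f))))
  Δ-reverse ((a , h) ∷ L) f g = begin
    form q (δ g) (blocks ((a , h) ∷ L) ⊗ F)
      ≈⟨ peel g a h L F ⟩
    form q (δ (suc (g ℕ.+ h))) (blocks L ⊗ F) + N * δ g * form q (δ h) (blocks L ⊗ F)
      ≈⟨ +-cong (Δ-reverse L f (suc (g ℕ.+ h))) (*-congˡ (Δ-reverse L f h)) ⟩
    form q (δ f) (rblocks L ⊗ downs (suc (suc (g ℕ.+ h)))) + N * δ g * form q (δ f) A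
      ≈⟨ +-cong (form-cong {y = δ f} refl refl merged)
           (solve 3 (λ x y z → x :* y :* z := x :* z :* y) refl N (δ g) (form q (δ f) A)) ⟩
    form q (δ f) (A ⊗ (G ⊗ Id)) + N * form q (δ f) A * δ g
      ≈⟨ +-cong (form-⊗ q (δ f) A (G ⊗ Id)) (*-congˡ (sym (form-Id g))) ⟩
    -- The prefix `A` is absorbed into the row vector, so that the last run of steps up can be
    -- handled by `form-peel` as if it came first.
    form x y (G ⊗ Id) + N * y * form q (δ g) Id
      ≈⟨ form-peel x y (suc a) g Id ⟨
    form x y (ups (suc a) ⊗ G ⊗ Id)
      ≈⟨ form-⊗ q (δ f) A (ups (suc a) ⊗ G ⊗ Id) ⟨
    form q (δ f) (A ⊗ ups (suc a) ⊗ G ⊗ Id)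
      ≈⟨ form-cong {y = δ f} refl refl
           (≈ᴹ-trans (⊗-cong (≈ᴹ-refl {A}) (⊗-cong (≈ᴹ-refl {ups (suc a)}) (⊗-identityʳ G)))
           (≈ᴹ-trans (≈ᴹ-sym (⊗-assoc A (ups (suc a)) G))
             (⊗-cong (≈ᴹ-sym (rblocks-∷ a h L)) (≈ᴹ-refl {G})))) ⟩
    form q (δ f) (rblocks ((a , h) ∷ L) ⊗ G) ∎
    where
    N = [ suc a ]q
    F = downs (suc f)
    G = downs (suc g)
    A = rblocks L ⊗ downs (suc h)
    x = q * m₀₀ A + δ f * m₁₀ A
    y = form q (δ f) A
    merged : rblocks L ⊗ downs (suc (suc (g ℕ.+ h))) ≈ᴹ A ⊗ (G ⊗ Id)
    merged = ≈ᴹ-trans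
      (⊗-cong (≈ᴹ-refl {rblocks L}) (≈ᴹ-sym (≡.subst (λ n → downs (suc h) ⊗ G ≈ᴹ downs n)
        (≡.cong suc (≡.trans (ℕ.+-suc h g) (≡.cong suc (ℕ.+-comm h g))))
        (downs-+ (suc h) (suc g)))))
      (≈ᴹ-trans (≈ᴹ-sym (⊗-assoc (rblocks L) (downs (suc h)) G))
        (⊗-cong (≈ᴹ-refl {A}) (≈ᴹ-sym (⊗-identityʳ G))))

  -- Peeling the first run of steps up leaves two terms. In the first, the neighbouring runs of
  -- steps down merge around the cycle and the induction applies; the other is `Δ-reverse`.
  trace-reverse : ∀ L f → trace (downs (suc f) ⊗ blocks L) ≈ trace (rblocks L ⊗ downs (suc f))
  trace-reverse [] f = trace-comm (downs (suc f)) Id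
  trace-reverse ((a , g) ∷ L) f = begin
    trace (F ⊗ blocks ((a , g) ∷ L))
      ≈⟨ trace-cong (⊗-cong (≈ᴹ-refl {F}) (blocks-∷ a g L)) ⟩
    trace (F ⊗ (U ⊗ G ⊗ blocks L))
      ≈⟨ trace-comm F (U ⊗ G ⊗ blocks L) ⟩
    trace ((U ⊗ G ⊗ blocks L) ⊗ F)
      ≈⟨ trace-cong (≈ᴹ-trans (⊗-assoc U (G ⊗ blocks L) F)
           (⊗-cong (≈ᴹ-refl {U}) (⊗-assoc G (blocks L) F))) ⟩
    trace (U ⊗ G ⊗ (blocks L ⊗ F))
      ≈⟨ trace-peel (suc a) g (blocks L ⊗ F) ⟩
    trace (G ⊗ (blocks L ⊗ F)) + N * form q (δ g) (blocks L ⊗ F)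
      ≈⟨ +-cong shorter (*-congˡ (Δ-reverse L f g)) ⟩
    trace (F ⊗ (rblocks L ⊗ G)) + N * form q (δ f) (rblocks L ⊗ G)
      ≈⟨ trace-peel (suc a) f (rblocks L ⊗ G) ⟨
    trace (U ⊗ F ⊗ (rblocks L ⊗ G))
      ≈⟨ trace-cong (⊗-assoc U F (rblocks L ⊗ G)) ⟨
    trace ((U ⊗ F) ⊗ (rblocks L ⊗ G))
      ≈⟨ trace-comm (U ⊗ F) (rblocks L ⊗ G) ⟩
    trace ((rblocks L ⊗ G) ⊗ (U ⊗ F))
      ≈⟨ trace-cong (≈ᴹ-trans (≈ᴹ-sym (⊗-assoc (rblocks L ⊗ G) U F))
           (⊗-cong (≈ᴹ-sym (rblocks-∷ a g L)) (≈ᴹ-refl {F}))) ⟩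
    trace (rblocks ((a , g) ∷ L) ⊗ F) ∎
    where
    N = [ suc a ]q
    F = downs (suc f)
    G = downs (suc g)
    U = ups (suc a)
    FG = downs (suc (suc (f ℕ.+ g)))
    FG≈ : F ⊗ G ≈ᴹ FG
    FG≈ = ≡.subst (λ n → F ⊗ G ≈ᴹ downs (suc n)) (ℕ.+-suc f g) (downs-+ (suc f) (suc g))
    GF≈ : G ⊗ F ≈ᴹ FG
    GF≈ = ≡.subst (λ n → G ⊗ F ≈ᴹ downs (suc n))
      (≡.trans (ℕ.+-suc g f) (≡.cong suc (ℕ.+-comm g f))) (downs-+ (suc g) (suc f))
    shorter : trace (G ⊗ (blocks L ⊗ F)) ≈ trace (F ⊗ (rblocks L ⊗ G))
    shorter = begin
      trace (G ⊗ (blocks L ⊗ F))  ≈⟨ trace-cong (⊗-assoc G (blocks L) F) ⟨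
      trace ((G ⊗ blocks L) ⊗ F)  ≈⟨ trace-comm (G ⊗ blocks L) F ⟩
      trace (F ⊗ (G ⊗ blocks L))  ≈⟨ trace-cong (⊗-assoc F G (blocks L)) ⟨
      trace ((F ⊗ G) ⊗ blocks L)  ≈⟨ trace-cong (⊗-cong FG≈ (≈ᴹ-refl {blocks L})) ⟩
      trace (FG ⊗ blocks L)       ≈⟨ trace-reverse L (suc (f ℕ.+ g)) ⟩
      trace (rblocks L ⊗ FG)      ≈⟨ trace-cong (⊗-cong (≈ᴹ-refl {rblocks L}) GF≈) ⟨
      trace (rblocks L ⊗ (G ⊗ F)) ≈⟨ trace-cong (⊗-assoc (rblocks L) G F) ⟨
      trace ((rblocks L ⊗ G) ⊗ F) ≈⟨ trace-comm (rblocks L ⊗ G) F ⟩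
      trace (F ⊗ (rblocks L ⊗ G)) ∎

  R-reverse : ∀ f L → R (reverse (chainWord f L)) ≈ R (chainWord f L)
  R-reverse f L = begin
    R (reverse (chainWord f L))
      ≡⟨ ≡.cong R (≡.trans (reverse-++ (replicate (suc f) down) (blockWord L))
           (≡.cong (reverse (blockWord L) ++_) (reverse-replicate (suc f) down))) ⟩
    R (reverse (blockWord L) ++ replicate (suc f) down)
      ≈⟨ trace-cong (matrix-++ (reverse (blockWord L)) (replicate (suc f) down)) ⟩
    trace (rblocks L ⊗ downs (suc f))
      ≈⟨ trace-reverse L f ⟨
    trace (downs (suc f) ⊗ blocks L)
      ≈⟨ trace-cong (matrix-++ (replicate (suc f) down) (blockWord L)) ⟨
    R (chainWord f L) ∎

  R-merge : ∀ f b L → R (chainWord f (b ∷ L)) ≈ R (blockWord (merge f b L))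
  R-merge f b L = trans (R-rotate (replicate (suc f) down) (blockWord (b ∷ L)))
    (reflexive (≡.cong R (≡.sym (blockWord-merge f b L))))

  -- The Cayley–Hamilton recurrence of the matrix of a step down.
  R-down-down : ∀ w → R (down ∷ down ∷ w) + q * R w ≈ R (down ∷ w) + q * R (down ∷ w)
  R-down-down w with matrix w
  ... | mat a b c d = solve 4 (λ q a c d →
    (((a :+ c) :+ q :* c) :+ q :* (q :* d)) :+ q :* (a :+ d) :=
    ((a :+ c) :+ q :* d) :+ q :* ((a :+ c) :+ q :* d)) refl q a c d

  ⊗-up : ∀ A → A ⊗ matrix (up ∷ []) ≈ᴹ
               mat (m₀₀ A + q * m₀₁ A) (q * m₀₁ A) (m₁₀ A + q * m₁₁ A) (q * m₁₁ A)
  ⊗-up (mat a b c d) = mat≈ (left a b) (right a b) (left c d) (right c d)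
    where
    left = λ a b → solve 3 (λ q a b →
      a :* con 1 :+ b :* (q :* (con 1 :+ con 0)) := a :+ q :* b) refl q a b
    right = λ a b → solve 3 (λ q a b →
      a :* con 0 :+ b :* (q :* (con 0 :+ con 1)) := q :* b) refl q a b

  ⊗-down : ∀ A → A ⊗ matrix (down ∷ []) ≈ᴹ
                 mat (m₀₀ A) (m₀₀ A + q * m₀₁ A) (m₁₀ A) (m₁₀ A + q * m₁₁ A)
  ⊗-down (mat a b c d) = mat≈ (left a b) (right a b) (left c d) (right c d)
    where
    left = λ a b → solve 3 (λ q a b →
      a :* (con 1 :+ con 0) :+ b :* (q :* con 0) := a) refl q a b
    right = λ a b → solve 3 (λ q a b →
      a :* (con 0 :+ con 1) :+ b :* (q :* con 1) := a :+ q :* b) refl q a b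

  -- The matrices of a word and of its transposed word are transposes of each
  -- other up to conjugation by diag(1, q).
  record Transposes (A B : Matrix) : Set ℓ where
    field
      ᵗ₀₀ : m₀₀ A ≈ m₀₀ B
      ᵗ₁₁ : m₁₁ A ≈ m₁₁ B
      ᵗ₁₀ : m₁₀ A ≈ q * m₀₁ B
      ᵗ₀₁ : q * m₀₁ A ≈ m₁₀ B

  transposes-congʳ : ∀ {A B C} → B ≈ᴹ C → Transposes A B → Transposes A C
  transposes-congʳ (mat≈ p r s t′) t = record
    { ᵗ₀₀ = trans ᵗ₀₀ p ; ᵗ₁₁ = trans ᵗ₁₁ t′ ; ᵗ₁₀ = trans ᵗ₁₀ (*-congˡ r) ; ᵗ₀₁ = trans ᵗ₀₁ s }
    where open Transposes t

  transpose-letter : ∀ d {A B} → Transposes A B →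
                     Transposes (letter d A) (B ⊗ matrix (opposite d ∷ []))
  transpose-letter up {mat a b c d} {B@(mat e f g h)} t =
    transposes-congʳ (≈ᴹ-sym (⊗-down B)) record
      { ᵗ₀₀ = ᵗ₀₀
      ; ᵗ₁₁ = trans (distribˡ q b d) (+-cong ᵗ₀₁ (*-congˡ ᵗ₁₁))
      ; ᵗ₁₀ = *-congˡ (+-cong ᵗ₀₀ ᵗ₁₀)
      ; ᵗ₀₁ = ᵗ₀₁
      }
    where open Transposes t
  transpose-letter down {mat a b c d} {B@(mat e f g h)} t =
    transposes-congʳ (≈ᴹ-sym (⊗-up B)) record
      { ᵗ₀₀ = +-cong ᵗ₀₀ ᵗ₁₀
      ; ᵗ₁₁ = *-congˡ ᵗ₁₁
      ; ᵗ₁₀ = *-congˡ ᵗ₁₀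
      ; ᵗ₀₁ = trans (distribˡ q b d) (+-cong ᵗ₀₁ (*-congˡ ᵗ₁₁))
      }
    where open Transposes t

  matrix-transposed : ∀ w → Transposes (matrix w) (matrix (transposed w))
  matrix-transposed []      = record
    { ᵗ₀₀ = refl ; ᵗ₁₁ = refl ; ᵗ₁₀ = sym (zeroʳ q) ; ᵗ₀₁ = zeroʳ q }
  matrix-transposed (d ∷ w) = ≡.subst (λ v → Transposes (matrix (d ∷ w)) (matrix v))
    (≡.sym (unfold-reverse (opposite d) (map opposite w)))
    (transposes-congʳ (≈ᴹ-sym (matrix-++ (transposed w) (opposite d ∷ [])))
      (transpose-letter d (matrix-transposed w)))

  R-dual : ∀ L → R (blockWord L) ≈ R (blockWord (dual L))
  R-dual L = trans (+-cong ᵗ₀₀ ᵗ₁₁) (reflexive (≡.cong R (≡.sym (blockWord-dual L))))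
    where open Transposes (matrix-transposed (blockWord L))

  -- In rletter, every bit has the opposite weight: this is the letter with q
  -- replaced by its inverse, times q.
  rletter : Direction → Matrix → Matrix
  rletter up   (mat a b c d) = mat (q * a) (q * b) (a + c) (b + d)
  rletter down (mat a b c d) = mat (q * (a + c)) (q * (b + d)) c d

  rmatrix : Word → Matrix
  rmatrix []      = Id
  rmatrix (d ∷ w) = rletter d (rmatrix w)

  -- The matrix rmatrix w is conjugate to the adjugate of matrix (reverse w), up to
  -- signs off the diagonal.
  record Adjugates (A B : Matrix) : Set ℓ where
    field
      ᵃ₀₀ : m₀₀ A ≈ m₁₁ B
      ᵃ₁₁ : m₁₁ A ≈ m₀₀ B
      ᵃ₁₀ : q * m₁₀ A ≈ m₁₀ B
      ᵃ₀₁ : m₀₁ A ≈ q * m₀₁ B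

  adjugates-congʳ : ∀ {A B C} → B ≈ᴹ C → Adjugates A B → Adjugates A C
  adjugates-congʳ (mat≈ p r s t′) t = record
    { ᵃ₀₀ = trans ᵃ₀₀ t′ ; ᵃ₁₁ = trans ᵃ₁₁ p ; ᵃ₁₀ = trans ᵃ₁₀ s ; ᵃ₀₁ = trans ᵃ₀₁ (*-congˡ r) }
    where open Adjugates t

  adjugate-letter : ∀ d {A B} → Adjugates A B →
                    Adjugates (rletter d A) (B ⊗ matrix (d ∷ []))
  adjugate-letter up {mat a b c d} {B@(mat e f g h)} t =
    adjugates-congʳ (≈ᴹ-sym (⊗-up B)) record
      { ᵃ₀₀ = *-congˡ ᵃ₀₀
      ; ᵃ₁₁ = trans (+-cong ᵃ₀₁ ᵃ₁₁) (+-comm (q * f) e)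
      ; ᵃ₁₀ = trans (distribˡ q a c) (trans (+-cong (*-congˡ ᵃ₀₀) ᵃ₁₀) (+-comm (q * h) g))
      ; ᵃ₀₁ = *-congˡ ᵃ₀₁
      }
    where open Adjugates t
  adjugate-letter down {mat a b c d} {B@(mat e f g h)} t =
    adjugates-congʳ (≈ᴹ-sym (⊗-down B)) record
      { ᵃ₀₀ = trans (distribˡ q a c) (trans (+-cong (*-congˡ ᵃ₀₀) ᵃ₁₀) (+-comm (q * h) g))
      ; ᵃ₁₁ = ᵃ₁₁
      ; ᵃ₁₀ = ᵃ₁₀
      ; ᵃ₀₁ = *-congˡ (trans (+-cong ᵃ₀₁ ᵃ₁₁) (+-comm (q * f) e))
      }
    where open Adjugates t

  rmatrix-adjugate : ∀ w → Adjugates (rmatrix w) (matrix (reverse w))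
  rmatrix-adjugate []      = record
    { ᵃ₀₀ = refl ; ᵃ₁₁ = refl ; ᵃ₁₀ = zeroʳ q ; ᵃ₀₁ = sym (zeroʳ q) }
  rmatrix-adjugate (d ∷ w) = ≡.subst (λ v → Adjugates (rmatrix (d ∷ w)) (matrix v))
    (≡.sym (unfold-reverse d w))
    (adjugates-congʳ (≈ᴹ-sym (matrix-++ (reverse w) (d ∷ [])))
      (adjugate-letter d (rmatrix-adjugate w)))

  trace-rmatrix : ∀ w → trace (rmatrix w) ≈ R (reverse w)
  trace-rmatrix w = trans (+-comm (m₀₀ (rmatrix w)) _) (+-cong ᵃ₁₁ ᵃ₀₀)
    where open Adjugates (rmatrix-adjugate w)

open import Algebra.Structures.Biased using (isCommutativeSemiringˡ)
open import Data.Bool.Base using (Bool; true; false; _∧_; _∨_; not; if_then_else_; T)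
open import Data.Bool.Properties using (∧-assoc; ∧-zeroʳ; T-∧)
open import Data.Empty using (⊥-elim)
open import Data.Fin.Relation.Unary.Top using (view; ‵fromℕ; ‵inject₁)
open import Data.Fin.Subset using (Subset; _∈_; ∣_∣; inside; outside)
open import Data.List.Relation.Unary.All using (All; []; _∷_)
open import Data.Nat.Base
open import Data.Nat.Divisibility using (∣⇒≤; ∣m+n∣m⇒∣n; ∣-refl)
open import Data.Nat.Properties
open import Data.Nat.Tactic.RingSolver using (solve-∀)
open import Data.Sum using (inj₁; inj₂)
open import Data.Unit.Base using (tt)
open import Data.Vec.Base as Vec using (Vec; []; _∷_; lookup; head)
open import Data.Vec.Properties using ([]=⇒lookup; lookup⇒[]=; toList-++; toList-replicate)
open import Function.Bundles using (Equivalence; mk⇔)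
open import Level using (0ℓ)
open import Relation.Binary.Construct.Closure.ReflexiveTransitive using (ε; _◅_)
open import Relation.Binary.Definitions using (tri<; tri≈; tri>)
open import Relation.Binary.PropositionalEquality hiding ([_])
open import Relation.Binary.Structures using (IsDecPartialOrder)
open import Relation.Nullary using (Dec; yes; no; does; contradiction)
open import Relation.Nullary.Decidable using (_×-dec_; _⊎-dec_; ¬?; does-⇔; T?)
open import Relation.Unary using (Decidable)

-- The semiring of polynomials

infixl 7 _⊛_
infixl 6 _⊕_

_⊕_ : Polynomial → Polynomial → Polynomial
(f ⊕ g) i = f i + g i

_⊛_ : Polynomial → Polynomial → Polynomial
(f ⊛ g) zero    = f 0 * g 0
(f ⊛ g) (suc i) = f 0 * g (suc i) + (f ∘ suc ⊛ g) i

0ₚ 1ₚ q : Polynomial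
0ₚ _ = 0
1ₚ zero    = 1
1ₚ (suc _) = 0
q zero    = 0
q (suc i) = 1ₚ i

⊛-cong : ∀ {f f′ g g′} → f ≗ f′ → g ≗ g′ → f ⊛ g ≗ f′ ⊛ g′
⊛-cong f≗ g≗ zero    = cong₂ _*_ (f≗ 0) (g≗ 0)
⊛-cong f≗ g≗ (suc i) =
  cong₂ _+_ (cong₂ _*_ (f≗ 0) (g≗ (suc i))) (⊛-cong (f≗ ∘ suc) g≗ i)

⊛-zeroˡ : ∀ f → 0ₚ ⊛ f ≗ 0ₚ
⊛-zeroˡ f zero    = refl
⊛-zeroˡ f (suc i) = ⊛-zeroˡ f i

⊛-identityˡ : ∀ f → 1ₚ ⊛ f ≗ f
⊛-identityˡ f zero    = +-identityʳ (f 0)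
⊛-identityˡ f (suc i) =
  trans (cong₂ _+_ (+-identityʳ (f (suc i))) (⊛-zeroˡ f i)) (+-identityʳ _)

⊛-distribʳ : ∀ h f g → (f ⊕ g) ⊛ h ≗ f ⊛ h ⊕ g ⊛ h
⊛-distribʳ h f g zero    = *-distribʳ-+ (h 0) (f 0) (g 0)
⊛-distribʳ h f g (suc i) =
  trans (cong ((f 0 + g 0) * h (suc i) +_) (⊛-distribʳ h (f ∘ suc) (g ∘ suc) i))
    (regroup (f 0) (g 0) (h (suc i)) _ _)
  where
  regroup : ∀ a b c x y → (a + b) * c + (x + y) ≡ (a * c + x) + (b * c + y)
  regroup = solve-∀

⊛-sucʳ : ∀ f g i → (f ⊛ g) (suc i) ≡ (f ⊛ (g ∘ suc)) i + f (suc i) * g 0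
⊛-sucʳ f g zero    = refl
⊛-sucʳ f g (suc i) =
  trans (cong (f 0 * g (2 + i) +_) (⊛-sucʳ (f ∘ suc) g i)) (sym (+-assoc (f 0 * g (2 + i)) _ _))

⊛-comm : ∀ f g → f ⊛ g ≗ g ⊛ f
⊛-comm f g zero    = *-comm (f 0) (g 0)
⊛-comm f g (suc i) = trans (⊛-sucʳ f g i) (trans
  (cong₂ _+_ (⊛-comm f (g ∘ suc) i) (*-comm (f (suc i)) (g 0)))
  (+-comm _ (g 0 * f (suc i))))

⊛-identityʳ : ∀ f → f ⊛ 1ₚ ≗ f
⊛-identityʳ f i = trans (⊛-comm f 1ₚ i) (⊛-identityˡ f i)

⊛-zeroʳ : ∀ f → f ⊛ 0ₚ ≗ 0ₚ
⊛-zeroʳ f i = trans (⊛-comm f 0ₚ i) (⊛-zeroˡ f i)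

⊛-scaleˡ : ∀ c f g → (λ i → c * f i) ⊛ g ≗ λ i → c * (f ⊛ g) i
⊛-scaleˡ c f g zero    = *-assoc c (f 0) (g 0)
⊛-scaleˡ c f g (suc i) =
  trans (cong₂ _+_ (*-assoc c (f 0) (g (suc i))) (⊛-scaleˡ c (f ∘ suc) g i))
    (sym (*-distribˡ-+ c (f 0 * g (suc i)) _))

⊛-assoc : ∀ f g h → (f ⊛ g) ⊛ h ≗ f ⊛ (g ⊛ h)
⊛-assoc f g h zero    = *-assoc (f 0) (g 0) (h 0)
⊛-assoc f g h (suc i) = begin
  f 0 * g 0 * h (suc i) + ((λ j → f 0 * g (suc j) + (f ∘ suc ⊛ g) j) ⊛ h) i
    ≡⟨ cong (f 0 * g 0 * h (suc i) +_) (⊛-distribʳ h _ (f ∘ suc ⊛ g) i) ⟩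
  f 0 * g 0 * h (suc i) + (((λ j → f 0 * g (suc j)) ⊛ h) i + ((f ∘ suc ⊛ g) ⊛ h) i)
    ≡⟨ cong (f 0 * g 0 * h (suc i) +_)
         (cong₂ _+_ (⊛-scaleˡ (f 0) (g ∘ suc) h i) (⊛-assoc (f ∘ suc) g h i)) ⟩
  f 0 * g 0 * h (suc i) + (f 0 * (g ∘ suc ⊛ h) i + (f ∘ suc ⊛ (g ⊛ h)) i)
    ≡⟨ regroup (f 0) (g 0) (h (suc i)) _ _ ⟩
  f 0 * (g 0 * h (suc i) + (g ∘ suc ⊛ h) i) + (f ∘ suc ⊛ (g ⊛ h)) i ∎
  where
  open ≡-Reasoning
  regroup : ∀ a b c x y → a * b * c + (a * x + y) ≡ a * (b * c + x) + y
  regroup = solve-∀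

polynomials : CommutativeSemiring 0ℓ 0ℓ
polynomials = record
  { _≈_ = _≗_
  ; _+_ = _⊕_
  ; _*_ = _⊛_
  ; 0#  = 0ₚ
  ; 1#  = 1ₚ
  ; isCommutativeSemiring = isCommutativeSemiringˡ record
    { +-isCommutativeMonoid = record
      { isMonoid = record
        { isSemigroup = record
          { isMagma = record
            { isEquivalence = ≗-isEquiv
            ; ∙-cong = λ f≗ g≗ i → cong₂ _+_ (f≗ i) (g≗ i)
            }
          ; assoc = λ f g h i → +-assoc (f i) (g i) (h i)
          }
        ; identity = (λ f i → refl) , λ f i → +-identityʳ (f i)
        }
      ; comm = λ f g i → +-comm (f i) (g i)
      }
    ; *-isCommutativeMonoid = record
      { isMonoid = record
        { isSemigroup = record
          { isMagma = record { isEquivalence = ≗-isEquiv ; ∙-cong = ⊛-cong }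
          ; assoc = ⊛-assoc
          }
        ; identity = ⊛-identityˡ , ⊛-identityʳ
        }
      ; comm = ⊛-comm
      }
    ; distribʳ = ⊛-distribʳ
    ; zeroˡ = ⊛-zeroˡ
    }
  }
  where
  open import Relation.Binary.Structures using (IsEquivalence)
  ≗-isEquiv : IsEquivalence (_≗_ {A = ℕ} {B = ℕ})
  ≗-isEquiv = record
    { refl = λ _ → refl ; sym = λ p i → sym (p i) ; trans = λ p r i → trans (p i) (r i) }

open Transfer polynomials q

-- Rising polynomials

-- Of two coefficients, the one nearer to d / 2 is the larger one, provided that
-- the nearer one has the larger index.
Rising : ℕ → Polynomial → Set
Rising d f = ∀ i j → j ≤ i → i + j ≤ d → f j ≤ f i

-- Naming the slack turns a linear inequality into an identity for the ring solver.
≤-by : ∀ {m n} k → m + k ≡ n → m ≤ n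
≤-by {m} k refl = m≤m+n m k

q-suc : ∀ f i → (q ⊛ f) (suc i) ≡ f i
q-suc f i = ⊛-identityˡ f i

rising-≗ : ∀ {d f g} → f ≗ g → Rising d f → Rising d g
rising-≗ f≗g r i j j≤i i+j≤d = subst₂ _≤_ (f≗g j) (f≗g i) (r i j j≤i i+j≤d)

rising-≤ : ∀ {d e f} → e ≤ d → Rising d f → Rising e f
rising-≤ e≤d r i j j≤i i+j≤e = r i j j≤i (≤-trans i+j≤e e≤d)

rising-⊕ : ∀ {d f g} → Rising d f → Rising d g → Rising d (f ⊕ g)
rising-⊕ r s i j j≤i i+j≤d = +-mono-≤ (r i j j≤i i+j≤d) (s i j j≤i i+j≤d)

rising-0 : ∀ {d} → Rising d 0ₚ
rising-0 _ _ _ _ = z≤n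

rising-q : ∀ {d f} → Rising d f → Rising (2 + d) (q ⊛ f)
rising-q r i       zero    _         _ = z≤n
rising-q {d} {f} r (suc i) (suc j) (s≤s j≤i) (s≤s i+j≤d) =
  subst₂ _≤_ (sym (q-suc f j)) (sym (q-suc f i))
    (r i j j≤i (≤-pred (subst (_≤ suc d) (+-suc i j) i+j≤d)))

q^-suc-⊛ : ∀ k f → q^ suc k ⊛ f ≗ q ⊛ (q^ k ⊛ f)
q^-suc-⊛ k f = ⊛-assoc q (q^ k) f

rising-q^ : ∀ k {d e f} → e ≤ 2 * k + d → Rising d f → Rising e (q^ k ⊛ f)
rising-q^ zero    {f = f} e≤ r = rising-≤ e≤ (rising-≗ (λ i → sym (⊛-identityˡ f i)) r)
rising-q^ (suc k) {d} {f = f} e≤ r =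
  rising-≤ (≤-trans e≤ (≤-reflexive (cong (_+ d) (*-suc 2 k))))
    (rising-≗ (λ i → sym (q^-suc-⊛ k f i)) (rising-q (rising-q^ k ≤-refl r)))

-- The left-hand coefficient is zero or that of `f` at `j - k`, and `i + (j - k) ≤ d`.
q^-⊛-≤ : ∀ k {d f} → Rising d f → ∀ i j → j ≤ i → i + j ≤ k + d → (q^ k ⊛ f) j ≤ f i
q^-⊛-≤ zero    {f = f} r i j j≤i i+j≤ =
  subst (_≤ f i) (sym (⊛-identityˡ f j)) (r i j j≤i i+j≤)
q^-⊛-≤ (suc k) {f = f} r i zero    _   _    = z≤n
q^-⊛-≤ (suc k) {d} {f = f} r i (suc j) j≤i i+j≤ =
  subst (_≤ f i) (sym (trans (q^-suc-⊛ k f (suc j)) (q-suc (q^ k ⊛ f) j)))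
    (q^-⊛-≤ k r i j (≤-trans (n≤1+n j) j≤i)
      (≤-pred (subst (_≤ suc (k + d)) (+-suc i j) i+j≤)))

[]-⊛ : ∀ n f → [ suc n ]q ⊛ f ≗ f ⊕ q ⊛ ([ n ]q ⊛ f)
[]-⊛ n f i = trans (⊛-distribʳ f 1ₚ (q ⊛ [ n ]q) i)
  (cong₂ _+_ (⊛-identityˡ f i) (⊛-assoc q [ n ]q f i))

[]-⊛′ : ∀ n f → [ suc n ]q ⊛ f ≗ [ n ]q ⊛ f ⊕ q^ n ⊛ f
[]-⊛′ n f i = trans (⊛-cong ([]-suc n) (λ _ → refl) i) (⊛-distribʳ f [ n ]q (q^ n) i)

q-zero : ∀ f → q ⊛ (0ₚ ⊛ f) ≗ 0ₚ
q-zero f i = trans (⊛-cong {f = q} (λ _ → refl) (⊛-zeroˡ f) i) (⊛-zeroʳ q i)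

-- Two windows of equal length are compared by matching the entries of one with
-- those of the other in reverse order.
rising-window : ∀ n {d f} → Rising d f → Rising (n + d) ([ suc n ]q ⊛ f)
rising-window zero {f = f} r = rising-≗ (λ i → sym (trans ([]-⊛ 0 f i)
  (trans (cong (f i +_) (q-zero f i)) (+-identityʳ (f i))))) r
rising-window (suc n) {d} {f} r i j j≤i i+j≤ with m≤n⇒m<n∨m≡n j≤i
... | inj₂ refl = ≤-refl
rising-window (suc n) {d} {f} r (suc i) j _ i+j≤ | inj₁ (s≤s j≤i) = begin
  ([ 2 + n ]q ⊛ f) j
    ≡⟨ []-⊛′ (suc n) f j ⟩
  ([ suc n ]q ⊛ f) j + (q^ suc n ⊛ f) j
    ≤⟨ +-mono-≤ (rising-window n r i j j≤i (≤-pred i+j≤))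
         (q^-⊛-≤ (suc n) r (suc i) j (m≤n⇒m≤1+n j≤i) i+j≤) ⟩
  ([ suc n ]q ⊛ f) i + f (suc i)
    ≡⟨ +-comm (([ suc n ]q ⊛ f) i) (f (suc i)) ⟩
  f (suc i) + ([ suc n ]q ⊛ f) i
    ≡⟨ cong (f (suc i) +_) (q-suc ([ suc n ]q ⊛ f) i) ⟨
  f (suc i) + (q ⊛ ([ suc n ]q ⊛ f)) (suc i)
    ≡⟨ []-⊛ (suc n) f (suc i) ⟨
  ([ 2 + n ]q ⊛ f) (suc i) ∎
  where open ≤-Reasoning

rising-[] : ∀ n {d e f} → suc e ≤ n + d → Rising d f → Rising e ([ n ]q ⊛ f)
rising-[] zero    {f = f} _   r = rising-≗ (λ i → sym (⊛-zeroˡ f i)) rising-0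
rising-[] (suc n) (s≤s e≤) r = rising-≤ e≤ (rising-window n r)

rising-1 : Rising 0 1ₚ
rising-1 zero zero _ _ = ≤-refl

rising-power : ∀ k {d} → d ≤ 2 * k → Rising d (q^ k)
rising-power k d≤ = rising-≗ (⊛-identityʳ (q^ k))
  (rising-q^ k (≤-trans d≤ (≤-reflexive (sym (+-identityʳ (2 * k))))) rising-1)

rising-interval : ∀ k n {e} → suc e ≤ n + 2 * k → Rising e (q^ k ⊛ [ n ]q)
rising-interval k n e≤ = rising-≗ (⊛-comm [ n ]q (q^ k)) (rising-[] n e≤ (rising-power k ≤-refl))

rising-[]₁ : ∀ n → Rising n [ suc n ]q
rising-[]₁ n = rising-≗ (⊛-identityʳ [ suc n ]q)
  (rising-[] (suc n) (≤-reflexive (sym (+-identityʳ (suc n)))) rising-1)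

-- The part `q [c]` sets the bound, with two units from `q` and `c - 1` from the window; the part
-- `q^(c+2)` would allow `2 c + 4`.
rising-δ : ∀ c {d e f} → e ≤ suc c + d → Rising d f → Rising e (δ c ⊛ f)
rising-δ c {d} {e} {f} e≤ r = rising-≗ expand (rising-⊕ (low c e≤)
  (rising-q^ (2 + c) (≤-trans e≤ (≤-by (3 + c) (eq c d))) r))
  where
  eq : ∀ c d → (suc c + d) + (3 + c) ≡ 2 * (2 + c) + d
  eq = solve-∀
  low : ∀ c → e ≤ suc c + d → Rising e (q ⊛ ([ c ]q ⊛ f))
  low zero    _  = rising-≗ (λ i → sym (q-zero f i)) rising-0
  low (suc c) e≤ = rising-≤ e≤ (rising-q (rising-window c r))
  expand : q ⊛ ([ c ]q ⊛ f) ⊕ q^ (2 + c) ⊛ f ≗ δ c ⊛ f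
  expand i = trans (cong₂ _+_ (sym (⊛-assoc q [ c ]q f i)) refl)
    (sym (⊛-distribʳ f (q ⊛ [ c ]q) (q^ (2 + c)) i))

rising-δ₁ : ∀ c → Rising (suc c) (δ c)
rising-δ₁ c = rising-≗ (⊛-identityʳ (δ c))
  (rising-δ c (≤-reflexive (sym (+-identityʳ (suc c)))) rising-1)

-- Palindromic polynomials

record Palindromic (n : ℕ) (f : Polynomial) : Set where
  field
    symmetric : ∀ i j → i + j ≡ n → f i ≡ f j
    vanishes  : ∀ i → n < i → f i ≡ 0
open Palindromic

palindromic-≗ : ∀ {n f g} → f ≗ g → Palindromic n f → Palindromic n g
palindromic-≗ f≗g p = record
  { symmetric = λ i j e → trans (sym (f≗g i)) (trans (symmetric p i j e) (f≗g j))
  ; vanishes  = λ i n<i → trans (sym (f≗g i)) (vanishes p i n<i)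
  }

palindromic-rising : ∀ {n f} → Palindromic (suc n) f → Rising n f → Rising (suc n) f
palindromic-rising p r i j j≤i i+j≤ with m≤n⇒m<n∨m≡n i+j≤
... | inj₁ (s≤s i+j≤n) = r i j j≤i i+j≤n
... | inj₂ i+j≡        = ≤-reflexive (symmetric p j i (trans (+-comm j i) i+j≡))

record Reversed (n : ℕ) (f g : Polynomial) : Set where
  field
    reversed  : ∀ i j → i + j ≡ n → f i ≡ g j
    vanishesˡ : ∀ i → n < i → f i ≡ 0
    vanishesʳ : ∀ i → n < i → g i ≡ 0
open Reversed

reversed-⊕ : ∀ {n f f′ g g′} → Reversed n f f′ → Reversed n g g′ →
             Reversed n (f ⊕ g) (f′ ⊕ g′)
reversed-⊕ r s = record
  { reversed  = λ i j e → cong₂ _+_ (reversed r i j e) (reversed s i j e)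
  ; vanishesˡ = λ i n<i → cong₂ _+_ (vanishesˡ r i n<i) (vanishesˡ s i n<i)
  ; vanishesʳ = λ i n<i → cong₂ _+_ (vanishesʳ r i n<i) (vanishesʳ s i n<i)
  }

reversed-sym : ∀ {n f g} → Reversed n f g → Reversed n g f
reversed-sym r = record
  { reversed  = λ i j e → sym (reversed r j i (trans (+-comm j i) e))
  ; vanishesˡ = vanishesʳ r
  ; vanishesʳ = vanishesˡ r
  }

reversed-qˡ : ∀ {n f g} → Reversed n f g → Reversed (suc n) (q ⊛ f) g
reversed-qˡ {n} {f} {g} r = record
  { reversed  = λ
    { zero    j refl → sym (vanishesʳ r (suc n) (n<1+n n))
    ; (suc i) j e    → trans (q-suc f i) (reversed r i j (suc-injective e)) }
  ; vanishesˡ = λ { (suc i) (s≤s n<i) → trans (q-suc f i) (vanishesˡ r i n<i) }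
  ; vanishesʳ = λ i n<i → vanishesʳ r i (<-trans (n<1+n n) n<i)
  }

reversed-qʳ : ∀ {n f g} → Reversed n f g → Reversed (suc n) f (q ⊛ g)
reversed-qʳ r = reversed-sym (reversed-qˡ (reversed-sym r))

reversed-0 : ∀ {n} → Reversed n 0ₚ 0ₚ
reversed-0 = record
  { reversed = λ _ _ _ → refl ; vanishesˡ = λ _ _ → refl ; vanishesʳ = λ _ _ → refl }

reversed-1 : Reversed 0 1ₚ 1ₚ
reversed-1 = record
  { reversed  = λ { zero zero _ → refl }
  ; vanishesˡ = λ { (suc i) _ → refl }
  ; vanishesʳ = λ { (suc i) _ → refl }
  }

record Reversedᴹ (n : ℕ) (A B : Matrix) : Set where
  constructor revᴹ
  field
    rev₀₀ : Reversed n (m₀₀ A) (m₀₀ B)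
    rev₀₁ : Reversed n (m₀₁ A) (m₀₁ B)
    rev₁₀ : Reversed n (m₁₀ A) (m₁₀ B)
    rev₁₁ : Reversed n (m₁₁ A) (m₁₁ B)

letter-reversed : ∀ d {n A B} → Reversedᴹ n A B → Reversedᴹ (suc n) (letter d A) (rletter d B)
letter-reversed up   (revᴹ a b c d) = revᴹ (reversed-qʳ a) (reversed-qʳ b)
  (reversed-qˡ (reversed-⊕ a c)) (reversed-qˡ (reversed-⊕ b d))
letter-reversed down (revᴹ a b c d) = revᴹ (reversed-qʳ (reversed-⊕ a c))
  (reversed-qʳ (reversed-⊕ b d)) (reversed-qˡ c) (reversed-qˡ d)

matrix-reversed : ∀ w → Reversedᴹ (length w) (matrix w) (rmatrix w)
matrix-reversed []      = revᴹ reversed-1 reversed-0 reversed-0 reversed-1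
matrix-reversed (d ∷ w) = letter-reversed d (matrix-reversed w)

R-reversed : ∀ w → Reversed (length w) (R w) (R (reverse w))
R-reversed w with matrix-reversed w
... | revᴹ a _ _ d = record
  { reversed  = λ i j e → trans (reversed (reversed-⊕ a d) i j e) (trace-rmatrix w j)
  ; vanishesˡ = vanishesˡ (reversed-⊕ a d)
  ; vanishesʳ = λ i n<i → trans (sym (trace-rmatrix w i)) (vanishesʳ (reversed-⊕ a d) i n<i)
  }

size : List Block → ℕ
size []            = 0
size ((a , c) ∷ L) = suc a + (suc c + size L)

length-run : ∀ n (d : Direction) w → length (replicate n d ++ w) ≡ n + length w
length-run n d w = trans (length-++ (replicate n d)) (cong (_+ length w) (length-replicate n))

length-blockWord : ∀ L → length (blockWord L) ≡ size L
length-blockWord []            = refl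
length-blockWord ((a , c) ∷ L) = trans (length-run (suc a) up _)
  (cong (suc a +_) (trans (length-run (suc c) down _) (cong (suc c +_) (length-blockWord L))))

length-chainWord : ∀ f L → length (chainWord f L) ≡ suc f + size L
length-chainWord f L =
  trans (length-run (suc f) down (blockWord L)) (cong (suc f +_) (length-blockWord L))

-- Complementing lower ideals reverses the coefficients at the price of reversing the word, and
-- `R-reverse` undoes the latter.
palindromic-chain : ∀ f L → Palindromic (suc f + size L) (R (chainWord f L))
palindromic-chain f L =
  subst (λ n → Palindromic n (R (chainWord f L))) (length-chainWord f L) record
  { symmetric = λ i j e → trans (reversed (R-reversed (chainWord f L)) i j e) (R-reverse f L j)
  ; vanishes  = vanishesˡ (R-reversed (chainWord f L))
  }

-- A block word whose runs of steps down are all single steps is no rotation of a chain word. The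
-- recurrence `R-down-down` instead expresses R of any block word through the chain words with one
-- and two steps down in front of it.
palindromic-blocks : ∀ L → Palindromic (size L) (R (blockWord L))
palindromic-blocks L = record
  { symmetric = λ i j e → +-cancelʳ-≡ (r₂ (suc i)) (r i) (r j) (begin
      r i + r₂ (suc i)    ≡⟨ step i ⟩
      r₁ (suc i) + r₁ i   ≡⟨ cong₂ _+_ (symmetric p₁ (suc i) j (cong suc e))
                               (symmetric p₁ i (suc j) (trans (+-suc i j) (cong suc e))) ⟩
      r₁ j + r₁ (suc j)   ≡⟨ +-comm (r₁ j) (r₁ (suc j)) ⟩
      r₁ (suc j) + r₁ j   ≡⟨ step j ⟨
      r j + r₂ (suc j)    ≡⟨ cong (r j +_) (symmetric p₂ (suc j) (suc i)
                               (cong suc (trans (+-suc j i) (cong suc (trans (+-comm j i) e))))) ⟩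
      r j + r₂ (suc i)    ∎)
  ; vanishes  = λ i n<i → vanishesˡ (R-reversed (blockWord L)) i
      (subst (_< i) (sym (length-blockWord L)) n<i)
  }
  where
  open ≡-Reasoning
  r  = R (blockWord L)
  r₁ = R (chainWord 0 L)
  r₂ = R (chainWord 1 L)
  p₁ = palindromic-chain 0 L
  p₂ = palindromic-chain 1 L
  step : ∀ i → r i + r₂ (suc i) ≡ r₁ (suc i) + r₁ i
  step i = trans (+-comm (r i) (r₂ (suc i)))
    (trans (cong (r₂ (suc i) +_) (sym (q-suc r i)))
      (trans (R-down-down (blockWord L) (suc i)) (cong (r₁ (suc i) +_) (q-suc r₁ i))))

-- Growing a run of steps up

cycle : ℕ → ℕ → List Block → Polynomial
cycle n f L = R (replicate n up ++ chainWord f L)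

palindromic-cycle : ∀ n f L → Palindromic (n + (suc f + size L)) (cycle n f L)
palindromic-cycle zero    f L = palindromic-chain f L
palindromic-cycle (suc n) f L = palindromic-blocks ((n , f) ∷ L)

cycle-suc : ∀ n f L → cycle (suc n) f L ≗ cycle n f L ⊕ q^ n ⊛ Δ f L
cycle-suc n f L i = begin
  cycle (suc n) f L i
    ≡⟨ R-peel (suc n) f L i ⟩
  r + ([ suc n ]q ⊛ Δ f L) i
    ≡⟨ cong (r +_) ([]-⊛′ n (Δ f L) i) ⟩
  r + (([ n ]q ⊛ Δ f L) i + (q^ n ⊛ Δ f L) i)
    ≡⟨ +-assoc r _ _ ⟨
  r + ([ n ]q ⊛ Δ f L) i + (q^ n ⊛ Δ f L) i
    ≡⟨ cong (_+ (q^ n ⊛ Δ f L) i) (R-peel n f L i) ⟨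
  cycle n f L i + (q^ n ⊛ Δ f L) i ∎
  where
  open ≡-Reasoning
  r = R (chainWord f L) i

-- Passing from `n` to `n + 1` steps up adds `q^n Δ`, which rises up to `2 n + d`; the last unit
-- comes from the symmetry. Starting at `m` steps instead of none lowers the demand on `Δ` by `m`
-- and skips cycles that fail to rise.
cycle-rising : ∀ k m f L {d} → Rising (m + (suc f + size L)) (cycle m f L) →
               Rising d (Δ f L) → suc f + size L ≤ m + d →
               Rising (k + m + (suc f + size L)) (cycle (k + m) f L)
cycle-rising zero    m f L     r s w≤ = r
cycle-rising (suc k) m f L {d} r s w≤ = palindromic-rising (palindromic-cycle (suc k + m) f L)
  (rising-≗ (λ i → sym (cycle-suc (k + m) f L i))
    (rising-⊕ (cycle-rising k m f L r s w≤) (rising-q^ (k + m) bound s)))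
  where
  bound : k + m + (suc f + size L) ≤ 2 * (k + m) + d
  bound = ≤-trans (+-monoʳ-≤ (k + m) w≤) (≤-by k (eq k m d))
    where
    eq : ∀ k m d → (k + m + (m + d)) + k ≡ 2 * (k + m) + d
    eq = solve-∀

cycle-1 : ∀ f L → cycle 1 f L ≗ R (chainWord f L) ⊕ Δ f L
cycle-1 f L i = trans (cycle-suc 0 f L i) (cong (R (chainWord f L) i +_) (⊛-identityˡ (Δ f L) i))

-- For i + j = width + 1, R(U X) has equal coefficients at i and j.
Δ-rising⁺ : ∀ f L → Rising (suc f + size L) (Δ f L) →
            Rising (suc f + size L) (R (chainWord f L)) →
            Rising (suc (suc f + size L)) (Δ f L)
Δ-rising⁺ f L s r i j j≤i i+j≤ with m≤n⇒m<n∨m≡n i+j≤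
... | inj₁ (s≤s i+j≤w) = s i j j≤i i+j≤w
... | inj₂ i+j≡        = +-cancelˡ-≤ (t i) (Δ f L j) (Δ f L i) (begin
  t i + Δ f L j ≤⟨ +-monoˡ-≤ (Δ f L j) (t≤ i j j≤i i+j≡) ⟩
  t j + Δ f L j ≡⟨ cycle-1 f L j ⟨
  cycle 1 f L j ≡⟨ symmetric (palindromic-cycle 1 f L) j i (trans (+-comm j i) i+j≡) ⟩
  cycle 1 f L i ≡⟨ cycle-1 f L i ⟩
  t i + Δ f L i ∎)
  where
  open ≤-Reasoning
  w = suc f + size L
  t = R (chainWord f L)
  p = palindromic-chain f L
  -- The symmetry of `t` has its centre at w / 2 and sends `i` to `j - 1`, one place below `j`.
  t≤ : ∀ i j → j ≤ i → i + j ≡ suc w → t i ≤ t j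
  t≤ i zero    _   e = ≤-trans (≤-reflexive (vanishes p i
    (≤-reflexive (sym (trans (sym (+-identityʳ i)) e))))) z≤n
  t≤ i (suc j) j<i e = ≤-trans
    (≤-reflexive (symmetric p i j (suc-injective (trans (sym (+-suc i j)) e))))
    (r (suc j) j (n≤1+n j) (≤-trans (+-monoˡ-≤ j j<i)
      (≤-reflexive (suc-injective (trans (sym (+-suc i j)) e)))))

-- For i + j = width, R(X) has equal coefficients at i and j.
Δ-rising⁰ : ∀ f L → Rising (f + size L) (Δ f L) →
            Rising (suc (suc f + size L)) (cycle 1 f L) →
            Rising (suc f + size L) (Δ f L)
Δ-rising⁰ f L s r i j j≤i i+j≤ with m≤n⇒m<n∨m≡n i+j≤
... | inj₁ (s≤s i+j≤w) = s i j j≤i i+j≤w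
... | inj₂ i+j≡        = +-cancelˡ-≤ (t j) (Δ f L j) (Δ f L i) (begin
  t j + Δ f L j ≡⟨ cycle-1 f L j ⟨
  cycle 1 f L j ≤⟨ r i j j≤i (m≤n⇒m≤1+n i+j≤) ⟩
  cycle 1 f L i ≡⟨ cycle-1 f L i ⟩
  t i + Δ f L i ≡⟨ cong (_+ Δ f L i) (symmetric (palindromic-chain f L) i j i+j≡) ⟩
  t j + Δ f L i ∎)
  where
  open ≤-Reasoning
  t = R (chainWord f L)

Δ-suc : ∀ f a g L → Δ f ((suc a , g) ∷ L) ≗
                    Δ f ((a , g) ∷ L) ⊕ q^ suc a ⊛ (δ f ⊛ Δ g L)
Δ-suc f a g L i = begin
  Δ (suc (f + g)) L i + ([ 2 + a ]q ⊛ δ f ⊛ Δ g L) i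
    ≡⟨ cong (Δ (suc (f + g)) L i +_) (⊛-assoc [ 2 + a ]q (δ f) (Δ g L) i) ⟩
  Δ (suc (f + g)) L i + ([ 2 + a ]q ⊛ (δ f ⊛ Δ g L)) i
    ≡⟨ cong (Δ (suc (f + g)) L i +_) ([]-⊛′ (suc a) (δ f ⊛ Δ g L) i) ⟩
  Δ (suc (f + g)) L i + (([ suc a ]q ⊛ (δ f ⊛ Δ g L)) i + (q^ suc a ⊛ (δ f ⊛ Δ g L)) i)
    ≡⟨ +-assoc (Δ (suc (f + g)) L i) _ _ ⟨
  Δ (suc (f + g)) L i + ([ suc a ]q ⊛ (δ f ⊛ Δ g L)) i + (q^ suc a ⊛ (δ f ⊛ Δ g L)) i
    ≡⟨ cong (λ x → Δ (suc (f + g)) L i + x + (q^ suc a ⊛ (δ f ⊛ Δ g L)) i)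
         (⊛-assoc [ suc a ]q (δ f) (Δ g L) i) ⟨
  Δ f ((a , g) ∷ L) i + (q^ suc a ⊛ (δ f ⊛ Δ g L)) i ∎
  where open ≡-Reasoning

open CommutativeSemiring polynomials using () renaming
  ( sym to ≗-sym; trans to ≗-trans; refl to ≗-refl
  ; +-cong to ⊕-cong; +-congˡ to ⊕-congˡ; +-congʳ to ⊕-congʳ
  ; *-congˡ to ⊛-congˡ; *-congʳ to ⊛-congʳ )
open import Algebra.Solver.Ring.NaturalCoefficients.Default polynomials
  using (solve; _:+_; _:*_; _:=_; con) renaming (Polynomial to Expr)

-- The inductive steps for cycles and chains

RisingCycle : List Block → Set
RisingCycle L = Rising (size L) (R (blockWord L))

width : ℕ → List Block → ℕ
width f L = suc f + size L

RisingΔ RisingΔ⁺ : ℕ → List Block → Set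
RisingΔ  f L = Rising (width f L) (Δ f L)
RisingΔ⁺ f L = Rising (suc (width f L)) (Δ f L)

weaken : ∀ f L → RisingΔ⁺ f L → RisingΔ f L
weaken f L = rising-≤ (n≤1+n (width f L))

size-merge : ∀ f b L → size (merge f b L) ≡ width f (b ∷ L)
size-merge f (a , g) []      = eq f a g
  where
  eq : ∀ f a g → suc a + (suc (suc (g + f)) + 0) ≡ suc f + (suc a + (suc g + 0))
  eq = solve-∀
size-merge f (a , g) (b ∷ L) = trans (cong (λ n → suc a + (suc g + n)) (size-merge f b L))
  (eq f a g (size (b ∷ L)))
  where
  eq : ∀ f a g n → suc a + (suc g + (suc f + n)) ≡ suc f + (suc a + (suc g + n))
  eq = solve-∀

chain-rising : ∀ f b L → RisingCycle (merge f b L) →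
               Rising (width f (b ∷ L)) (R (chainWord f (b ∷ L)))
chain-rising f b L r = rising-≗ (λ i → sym (R-merge f b L i))
  (subst (λ n → Rising n (R (blockWord (merge f b L)))) (size-merge f b L) r)

-- The growth starts from no step up at all, where the cycle is the merged one.
extend : ∀ n f b L → RisingCycle (merge f b L) → RisingΔ f (b ∷ L) →
         RisingCycle ((n , f) ∷ b ∷ L)
extend n f b L r s = subst (λ m → Rising (m + width f (b ∷ L)) (cycle m f (b ∷ L)))
  (+-identityʳ (suc n)) (cycle-rising (suc n) 0 f (b ∷ L) (chain-rising f b L r) s ≤-refl)

strengthen : ∀ f b L → RisingCycle (merge f b L) → RisingΔ f (b ∷ L) → RisingΔ⁺ f (b ∷ L)
strengthen f b L r s = Δ-rising⁺ f (b ∷ L) s (chain-rising f b L r)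

-- One more step up adds one to the width, which is exactly the surplus in `RisingΔ⁺`; the new term
-- is shifted far enough by `q^(a+1)`.
Δ-step : ∀ f a g L → RisingΔ⁺ f ((a , g) ∷ L) → RisingΔ g L → RisingΔ f ((suc a , g) ∷ L)
Δ-step f a g L r s = rising-≗ (≗-sym (Δ-suc f a g L)) (rising-⊕
  (rising-≤ (≤-reflexive (+-suc (suc f) (suc a + width g L))) r)
  (rising-q^ (suc a) (≤-by a (eq f a (width g L))) (rising-δ f ≤-refl s)))
  where
  eq : ∀ f a w → suc f + (suc (suc a) + w) + a ≡ 2 * suc a + (suc f + w)
  eq = solve-∀

one-window : ∀ f → [ 1 ]q ⊛ f ≗ f
one-window f = solve 2 (λ q f → (con 1 :+ q :* con 0) :* f := f) ≗-refl q f

Δ-first : ∀ f g L → Δ (suc (f + g)) L ⊕ δ f ⊛ Δ g L ≗ Δ f ((0 , g) ∷ L)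
Δ-first f g L = ⊕-congˡ {x = Δ (suc (f + g)) L} (⊛-congʳ (≗-sym (one-window (δ f))))

width-first : ∀ f g L → width f ((0 , g) ∷ L) ≡ suc (width (suc (f + g)) L)
width-first f g L = eq f g (size L)
  where
  eq : ∀ f g n → suc f + (1 + (suc g + n)) ≡ suc (suc (suc (f + g)) + n)
  eq = solve-∀

-- For a single step up, each term of the product formula is one unit short of the width, hence the
-- two stronger hypotheses. Every further step needs a strengthening before it, and so the merged
-- cycle for each shorter run.
peel⁺ : ∀ f a g L → RisingΔ⁺ (suc (f + g)) L → RisingΔ⁺ g L →
        (∀ b → b < a → RisingCycle (merge f (b , g) L)) → RisingΔ f ((a , g) ∷ L)
peel⁺ f zero    g L r s t = rising-≗ (Δ-first f g L) (rising-⊕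
  (rising-≤ (≤-reflexive (width-first f g L)) r)
  (rising-δ f ≤-refl s))
peel⁺ f (suc a) g L r s t = Δ-step f a g L
  (strengthen f (a , g) L (t a (n<1+n a))
    (peel⁺ f a g L r s (λ b b<a → t b (m<n⇒m<1+n b<a))))
  (weaken g L s)

size-++ : ∀ L L′ → size (L ++ L′) ≡ size L + size L′
size-++ []            L′ = refl
size-++ ((a , c) ∷ L) L′ = trans (cong (λ n → suc a + (suc c + n)) (size-++ L L′))
  (eq a c (size L) (size L′))
  where
  eq : ∀ a c m n → suc a + (suc c + (m + n)) ≡ suc a + (suc c + m) + n
  eq = solve-∀

rotate : ∀ L L′ → RisingCycle (L ++ L′) → RisingCycle (L′ ++ L)
rotate L L′ r = subst (λ n → Rising n (R (blockWord (L′ ++ L))))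
  (trans (size-++ L L′) (trans (+-comm (size L) (size L′)) (sym (size-++ L′ L))))
  (rising-≗ words r)
  where
  words : R (blockWord (L ++ L′)) ≗ R (blockWord (L′ ++ L))
  words i = trans (cong (λ w → R w i) (blockWord-++ L L′))
    (trans (R-rotate (blockWord L) (blockWord L′) i)
      (cong (λ w → R w i) (sym (blockWord-++ L′ L))))

size-dual : ∀ L → size (dual L) ≡ size L
size-dual []            = refl
size-dual ((a , c) ∷ L) = trans (size-++ (dual L) ((c , a) ∷ []))
  (trans (cong (_+ _) (size-dual L)) (eq a c (size L)))
  where
  eq : ∀ a c n → n + (suc c + (suc a + 0)) ≡ suc a + (suc c + n)
  eq = solve-∀

undual : ∀ L → RisingCycle (dual L) → RisingCycle L
undual L r = subst (λ n → Rising n (R (blockWord L))) (size-dual L)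
  (rising-≗ (λ i → sym (R-dual L i)) r)

-- Cycles of one or two blocks

R-downs : ∀ c → R (chainWord c []) ≗ 1ₚ ⊕ q^ suc c
R-downs c i = trans (cong (λ w → R w i) (++-identityʳ (replicate (suc c) down)))
  (trace-cong (matrix-down (suc c)) i)

-- Growth starts at one step up, where the poset is a chain of `c + 2` elements. With no step up, R
-- is `1 + q^(c+1)`, which does not rise for `c > 0`.
rising₁ : ∀ a c → RisingCycle ((a , c) ∷ [])
rising₁ a c = subst₂ Rising (eq a c) (cong (λ n → cycle n c []) (+-comm a 1))
  (cycle-rising a 1 c [] (rising-≗ (≗-sym two) (rising-≤ (≤-reflexive (eq′ c)) (rising-[]₁ (2 + c))))
    (rising-δ₁ c) (≤-by 1 (eq″ c)))
  where
  eq : ∀ a c → a + 1 + (suc c + 0) ≡ suc a + (suc c + 0)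
  eq = solve-∀
  eq′ : ∀ c → 1 + (suc c + 0) ≡ 2 + c
  eq′ = solve-∀
  eq″ : ∀ c → suc c + 0 + 1 ≡ 1 + suc c
  eq″ = solve-∀
  two : cycle 1 c [] ≗ [ 3 + c ]q
  two = ≗-trans (cycle-1 c []) (≗-trans (⊕-congʳ {x = δ c} (R-downs c))
    (≗-trans (solve 3 (λ q x y → (con 1 :+ q :* y) :+ (q :* x :+ q :* (q :* y)) :=
        ((con 1 :+ q :* x) :+ q :* y) :+ q :* (q :* y)) ≗-refl q [ c ]q (q^ c))
      (≗-sym (≗-trans ([]-suc (2 + c)) (⊕-congʳ ([]-suc (suc c)))))))

Exceptional : Block → Block → Set
Exceptional (a , c) (b , d) = (a ≡ b × c ≡ 0 × d ≡ 0) ⊎ (c ≡ d × a ≡ 0 × b ≡ 0)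

-- The polynomial is `q + q^3 + [b+1] q^4`; its gap at `q^2` keeps the bound at 2 whatever `b` is.
rising-Δ₀ : ∀ b → Rising 2 (Δ 0 ((b , 0) ∷ []))
rising-Δ₀ b = rising-⊕ (rising-δ₁ 1)
  (rising-≗ (≗-sym (⊛-assoc [ suc b ]q (δ 0) (δ 0))) (rising-[] (suc b) (≤-by b (eq b))
    (rising-≤ (s≤s (s≤s z≤n)) square)))
  where
  eq : ∀ b → 3 + b ≡ suc b + 2
  eq = solve-∀
  square : Rising 2 (δ 0 ⊛ δ 0)
  square = rising-δ 0 ≤-refl (rising-δ₁ 0)

-- Equal runs are exceptional, so growth starts with the first run one step longer than the second.
-- There R is `[2b+6] + q [b+1] [b+4]`, both summands symmetric about (2b+5)/2, and with `b + 2`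
-- steps already in place the bound 2 of `rising-Δ₀` suffices.
rising-peaks : ∀ k b → RisingCycle ((k + suc b , 0) ∷ (b , 0) ∷ [])
rising-peaks k b = subst (λ m → Rising (m + width 0 L) (cycle m 0 L)) (+-suc k (suc b))
  (cycle-rising k (2 + b) 0 L (rising-≗ (≗-sym explicit) (rising-⊕
      (rising-≤ (≤-reflexive (eq₁ b)) (rising-[]₁ (2 * b + 5)))
      (rising-≤ (≤-reflexive (eq₂ b)) (rising-q (rising-[] (suc b) ≤-refl (rising-[]₁ (3 + b)))))))
    (rising-Δ₀ b) (≤-by 1 (eq₃ b)))
  where
  L = (b , 0) ∷ []
  eq₁ : ∀ b → 2 + b + (1 + (suc b + (1 + 0))) ≡ 2 * b + 5
  eq₁ = solve-∀
  eq₂ : ∀ b → 2 + b + (1 + (suc b + (1 + 0))) ≡ 2 + (b + (3 + b))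
  eq₂ = solve-∀
  eq₃ : ∀ b → 1 + (suc b + (1 + 0)) + 1 ≡ 2 + b + 2
  eq₃ = solve-∀
  x = [ suc b ]q
  y = q^ suc b
  long : [ suc (2 * b + 5) ]q ≗ [ 4 + suc b ]q ⊕ q^ (4 + suc b) ⊛ x
  long = ≗-trans (λ i → cong (λ n → [ n ]q i) (eq b)) ([]-+ (4 + suc b) (suc b))
    where
    eq : ∀ b → suc (2 * b + 5) ≡ 4 + suc b + suc b
    eq = solve-∀
  common : Polynomial
  common = 1ₚ ⊕ q ⊛ (1ₚ ⊕ q ⊛ (1ₚ ⊕ q)) ⊕ x ⊛ (q ⊛ (1ₚ ⊕ q ⊛ (1ₚ ⊕ q ⊛ (1ₚ ⊕ q))))
  explicit : cycle (2 + b) 0 L ≗ [ suc (2 * b + 5) ]q ⊕ q ⊛ ([ suc b ]q ⊛ [ 4 + b ]q)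
  explicit = begin
    cycle (2 + b) 0 L
      ≈⟨ R-peel (2 + b) 0 L ⟩
    R (chainWord 0 L) ⊕ [ 2 + b ]q ⊛ Δ 0 L
      ≈⟨ ⊕-congʳ (≗-trans (R-merge 0 (b , 0) [])
           (≗-trans (R-peel (suc b) 1 []) (⊕-congʳ (R-downs 1)))) ⟩
    1ₚ ⊕ q^ 2 ⊕ x ⊛ δ 1 ⊕ [ 2 + b ]q ⊛ Δ 0 L
      ≈⟨ solve 2 (λ q x →
           con 1 :+ q :* (q :* con 1) :+
           x :* (q :* (con 1 :+ q :* con 0) :+ q :* (q :* (q :* con 1))) :+
           (con 1 :+ q :* x) :* ((q :* (con 1 :+ q :* con 0) :+ q :* (q :* (q :* con 1))) :+
             x :* (q :* con 0 :+ q :* (q :* con 1)) :* (q :* con 0 :+ q :* (q :* con 1))) :=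
           (con 1 :+ q :* (con 1 :+ q :* (con 1 :+ q)) :+
             x :* (q :* (con 1 :+ q :* (con 1 :+ q :* (con 1 :+ q))))) :+
           q :* (q :* (q :* (q :* (x :* (con 1 :+ q :* x)))))) ≗-refl q x ⟩
    common ⊕ q ⊛ (q ⊛ (q ⊛ (q ⊛ (x ⊛ [ 2 + b ]q))))
      ≈⟨ ⊕-congˡ {x = common} (⊛-congˡ {x = q} (⊛-congˡ {x = q} (⊛-congˡ {x = q} (⊛-congˡ {x = q}
           (⊛-congˡ {x = x} ([]-suc (suc b))))))) ⟩
    common ⊕ q ⊛ (q ⊛ (q ⊛ (q ⊛ (x ⊛ (x ⊕ y)))))
      ≈⟨ solve 3 (λ q x y →
           (con 1 :+ q :* (con 1 :+ q :* (con 1 :+ q)) :+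
             x :* (q :* (con 1 :+ q :* (con 1 :+ q :* (con 1 :+ q))))) :+
           q :* (q :* (q :* (q :* (x :* (x :+ y))))) :=
           ((con 1 :+ q :* (con 1 :+ q :* (con 1 :+ q :* (con 1 :+ q :* x)))) :+
             q :* (q :* (q :* (q :* y))) :* x) :+
           q :* (x :* (con 1 :+ q :* (con 1 :+ q :* (con 1 :+ q :* x))))) ≗-refl q x y ⟩
    [ 4 + suc b ]q ⊕ q^ (4 + suc b) ⊛ x ⊕ q ⊛ (x ⊛ [ 4 + b ]q)
      ≈⟨ ⊕-congʳ {x = q ⊛ (x ⊛ [ 4 + b ]q)} long ⟨
    [ suc (2 * b + 5) ]q ⊕ q ⊛ (x ⊛ [ 4 + b ]q) ∎
    where open import Relation.Binary.Reasoning.Setoid (CommutativeSemiring.setoid polynomials)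

ordered : ∀ {x y} → x < y → RisingCycle ((y , 0) ∷ (x , 0) ∷ [])
ordered {x} {y} x<y = subst (λ z → RisingCycle ((z , 0) ∷ (x , 0) ∷ []))
  (m∸n+n≡m x<y) (rising-peaks (y ∸ suc x) x)

-- The product formula stops one unit below the width, because of the gap in its single `δ`. The
-- first missing unit comes from the cycle with one more step up, which read backwards has single
-- steps down and unequal runs of steps up; the second comes from the merged cycle, which is a
-- single block.
rising-pair-Δ : ∀ c b → ¬ c ≡ b → RisingΔ⁺ c ((0 , b) ∷ [])
rising-pair-Δ c b c≢b = strengthen c (0 , b) [] (rising₁ 0 (suc (b + c)))
  (Δ-rising⁰ c ((0 , b) ∷ []) low (undual ((0 , c) ∷ (0 , b) ∷ []) peaks))
  where
  low : Rising (c + (1 + (suc b + 0))) (Δ c ((0 , b) ∷ []))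
  low = rising-≗ (Δ-first c b []) (rising-⊕
    (rising-≤ (≤-reflexive (eq c b)) (rising-δ₁ (suc (c + b))))
    (rising-δ c (≤-reflexive (eq′ c b)) (rising-δ₁ b)))
    where
    eq : ∀ c b → c + (1 + (suc b + 0)) ≡ suc (suc (c + b))
    eq = solve-∀
    eq′ : ∀ c b → c + (1 + (suc b + 0)) ≡ suc c + suc b
    eq′ = solve-∀
  peaks : RisingCycle ((b , 0) ∷ (c , 0) ∷ [])
  peaks with <-cmp b c
  ... | tri< b<c _ _ = rotate ((c , 0) ∷ []) ((b , 0) ∷ []) (ordered b<c)
  ... | tri≈ _ b≡c _ = ⊥-elim (c≢b (sym b≡c))
  ... | tri> _ _ c<b = ordered c<b

climb : ∀ f g k a → RisingΔ⁺ f ((a , g) ∷ []) → RisingΔ⁺ f ((k + a , g) ∷ [])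
climb f g zero    a r = r
climb f g (suc k) a r = strengthen f (suc k + a , g) [] (rising₁ (suc k + a) (suc (g + f)))
  (Δ-step f (k + a) g [] (climb f g k a r)
    (rising-≤ (≤-reflexive (+-identityʳ (suc g))) (rising-δ₁ g)))

module Square (e : ℕ) where

  open import Relation.Binary.Reasoning.Setoid (CommutativeSemiring.setoid polynomials)

  c = suc e
  x = [ e ]q
  s = [ suc e ]q
  y = q^ e
  A = [ 3 + (e + e) ]q
  Y = q ⊛ (q ⊛ (q ⊛ (y ⊛ y)))

  power : q^ (3 + (e + e)) ≗ Y
  power = ⊛-congˡ {x = q} (⊛-congˡ {x = q} (⊛-congˡ {x = q} (q^-+ e e)))

  rest : Polynomial
  rest = q ⊛ (q ⊛ (x ⊛ [ 3 + e ]q)) ⊕ q^ (4 + e) ⊛ s ⊕ q^ (6 + (e + e))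

  rising-rest : Rising (2 * e + 5) rest
  rising-rest = rising-⊕ (rising-⊕
    (rising-≤ (≤-reflexive (eq₁ e)) (rising-q (rising-q
      (rising-[] e {e = 1 + 2 * e} (≤-reflexive (eq₂ e)) (rising-[]₁ (2 + e))))))
    (rising-interval (4 + e) (suc e) (≤-by (3 + e) (eq₃ e))))
    (rising-power (6 + (e + e)) (≤-by (7 + 2 * e) (eq₄ e)))
    where
    eq₁ : ∀ e → 2 * e + 5 ≡ 4 + (1 + 2 * e)
    eq₁ = solve-∀
    eq₂ : ∀ e → suc (1 + 2 * e) ≡ e + (2 + e)
    eq₂ = solve-∀
    eq₃ : ∀ e → suc (2 * e + 5) + (3 + e) ≡ suc e + 2 * (4 + e)
    eq₃ = solve-∀
    eq₄ : ∀ e → 2 * e + 5 + (7 + 2 * e) ≡ 2 * (6 + (e + e))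
    eq₄ = solve-∀

  -- The width is `2 e + 5`, and the decomposition isolates the only summand that does not rise so
  -- far: `q^(2+e)` rises up to `2 e + 4`.
  Δ-single : Δ c ((0 , c) ∷ []) ≗ q^ (2 + e) ⊕ q ⊛ [ 5 + (e + e) ]q ⊕ rest
  Δ-single = begin
    Δ c ((0 , c) ∷ [])
      ≈⟨ Δ-first c c [] ⟨
    δ (suc (c + c)) ⊕ δ c ⊛ δ c
      ≈⟨ ⊕-congʳ {x = δ c ⊛ δ c} (λ i → cong (λ n → δ n i) (eq e)) ⟩
    q ⊛ A ⊕ q ⊛ (q ⊛ q^ (3 + (e + e))) ⊕ δ c ⊛ δ c
      ≈⟨ ⊕-congʳ {x = δ c ⊛ δ c} (⊕-congˡ {x = q ⊛ A} (⊛-congˡ {x = q} (⊛-congˡ {x = q} power))) ⟩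
    q ⊛ A ⊕ q ⊛ (q ⊛ Y) ⊕ δ c ⊛ δ c
      ≈⟨ solve 4 (λ q s y a →
           q :* a :+ q :* (q :* (q :* (q :* (q :* (y :* y))))) :+
             (q :* s :+ q :* (q :* (q :* y))) :* (q :* s :+ q :* (q :* (q :* y))) :=
           common q s y a :+ q :* q :* s :* s :+ q :* q :* q :* q :* y :* s)
         ≗-refl q s y A ⟩
    M ⊕ q ⊛ q ⊛ s ⊛ s ⊕ q ⊛ q ⊛ q ⊛ q ⊛ y ⊛ s
      ≈⟨ ⊕-cong (⊕-congˡ {x = M} (⊛-congˡ {x = q ⊛ q ⊛ s} ([]-suc e)))
           (⊛-congˡ {x = q ⊛ q ⊛ q ⊛ q ⊛ y} ([]-suc e)) ⟩
    M ⊕ q ⊛ q ⊛ s ⊛ (x ⊕ y) ⊕ q ⊛ q ⊛ q ⊛ q ⊛ y ⊛ (x ⊕ y)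
      ≈⟨ solve 5 (λ q s x y m →
           m :+ q :* q :* s :* (x :+ y) :+ q :* q :* q :* q :* y :* (x :+ y) :=
           m :+ q :* q :* x :* s :+ q :* q :* y :* s :+ q :* q :* q :* q :* y :* (x :+ y))
         ≗-refl q s x y M ⟩
    M ⊕ q ⊛ q ⊛ x ⊛ s ⊕ q ⊛ q ⊛ y ⊛ s ⊕ q ⊛ q ⊛ q ⊛ q ⊛ y ⊛ (x ⊕ y)
      ≈⟨ solve 5 (λ q s x y a →
           common q s y a :+ q :* q :* x :* s :+ q :* q :* y :* (con 1 :+ q :* x) :+
             q :* q :* q :* q :* y :* (x :+ y) :=
           q :* (q :* y) :+
             q :* ((a :+ q :* (q :* (q :* (y :* y)))) :+ q :* (q :* (q :* (q :* (y :* y))))) :+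
             ((q :* (q :* (x :* ((s :+ q :* y) :+ q :* (q :* y)))) :+
               q :* (q :* (q :* (q :* y))) :* s) :+
             q :* (q :* (q :* (q :* (q :* (q :* (y :* y)))))))) ≗-refl q s x y A ⟩
    q^ (2 + e) ⊕ q ⊛ (A ⊕ Y ⊕ q ⊛ Y) ⊕
      (q ⊛ (q ⊛ (x ⊛ (s ⊕ q ⊛ y ⊕ q ⊛ (q ⊛ y)))) ⊕ q^ (4 + e) ⊛ s ⊕ q ⊛ (q ⊛ (q ⊛ Y)))
      ≈⟨ ⊕-cong (⊕-congˡ {x = q^ (2 + e)} (⊛-congˡ {x = q} long)) (⊕-cong
           (⊕-congʳ {x = q^ (4 + e) ⊛ s} (⊛-congˡ {x = q} (⊛-congˡ {x = q} (⊛-congˡ {x = x} three))))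
           (⊛-congˡ {x = q} (⊛-congˡ {x = q} (⊛-congˡ {x = q} power)))) ⟨
    q^ (2 + e) ⊕ q ⊛ [ 5 + (e + e) ]q ⊕ rest ∎
    where
    eq : ∀ e → suc (suc e + suc e) ≡ 3 + (e + e)
    eq = solve-∀
    common : ∀ {n} (q s y a : Expr n) → Expr n
    common q s y a =
      q :* a :+ q :* (q :* (q :* (q :* (q :* (y :* y))))) :+
      q :* (q :* (q :* (q :* (q :* (q :* (y :* y)))))) :+ q :* (q :* (q :* (q :* (s :* y))))
    M = q ⊛ A ⊕ q ⊛ (q ⊛ (q ⊛ (q ⊛ (q ⊛ (y ⊛ y))))) ⊕
        q ⊛ (q ⊛ (q ⊛ (q ⊛ (q ⊛ (q ⊛ (y ⊛ y)))))) ⊕ q ⊛ (q ⊛ (q ⊛ (q ⊛ (s ⊛ y))))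
    long : [ 5 + (e + e) ]q ≗ A ⊕ Y ⊕ q ⊛ Y
    long = ≗-trans ([]-suc (4 + (e + e))) (⊕-cong
      (≗-trans ([]-suc (3 + (e + e))) (⊕-congˡ {x = A} power)) (⊛-congˡ {x = q} power))
    three : [ 3 + e ]q ≗ s ⊕ q ⊛ y ⊕ q ⊛ (q ⊛ y)
    three = ≗-trans ([]-suc (2 + e)) (⊕-congʳ {x = q ⊛ (q ⊛ y)} ([]-suc (suc e)))

  -- The summands q^(2+e) of Δ-single and q^(3+e) of q (δ c)² combine to an interval.
  rising-twice : Rising (2 * e + 5) (Δ c ((1 , c) ∷ []))
  rising-twice = rising-≗ (≗-sym expand) (rising-⊕ (rising-⊕ (rising-⊕ (rising-⊕ (rising-⊕ (rising-⊕
    (rising-interval (2 + e) 2 (≤-reflexive (eq₁ e)))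
    (rising-≤ (≤-by 1 (eq₂ e)) (rising-q (rising-[]₁ (4 + (e + e))))))
    rising-rest)
    (rising-≤ (≤-by 1 (eq₃ e)) (rising-q (rising-q (rising-q
      (rising-[] e {e = 2 * e} (≤-reflexive (eq₄ e)) (rising-[]₁ (suc e))))))))
    (rising-interval (5 + e) (suc e) (≤-by (5 + e) (eq₅ e))))
    (rising-interval (5 + e) (suc e) (≤-by (5 + e) (eq₅ e))))
    (rising-power (7 + (e + e)) (≤-by (9 + 2 * e) (eq₆ e))))
    where
    eq₁ : ∀ e → suc (2 * e + 5) ≡ 2 + 2 * (2 + e)
    eq₁ = solve-∀
    eq₂ : ∀ e → 2 * e + 5 + 1 ≡ 2 + (4 + (e + e))
    eq₂ = solve-∀
    eq₃ : ∀ e → 2 * e + 5 + 1 ≡ 6 + 2 * e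
    eq₃ = solve-∀
    eq₄ : ∀ e → suc (2 * e) ≡ e + suc e
    eq₄ = solve-∀
    eq₅ : ∀ e → suc (2 * e + 5) + (5 + e) ≡ suc e + 2 * (5 + e)
    eq₅ = solve-∀
    eq₆ : ∀ e → 2 * e + 5 + (9 + 2 * e) ≡ 2 * (7 + (e + e))
    eq₆ = solve-∀
    B = q ⊛ [ 5 + (e + e) ]q
    expand : Δ c ((1 , c) ∷ []) ≗
      q^ (2 + e) ⊛ [ 2 ]q ⊕ B ⊕ rest ⊕ q ⊛ (q ⊛ (q ⊛ (x ⊛ [ 2 + e ]q))) ⊕
      q^ (5 + e) ⊛ s ⊕ q^ (5 + e) ⊛ s ⊕ q^ (7 + (e + e))
    expand = begin
      Δ c ((1 , c) ∷ [])
        ≈⟨ Δ-suc c 0 c [] ⟩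
      Δ c ((0 , c) ∷ []) ⊕ q^ 1 ⊛ (δ c ⊛ δ c)
        ≈⟨ ⊕-congʳ {x = q^ 1 ⊛ (δ c ⊛ δ c)} Δ-single ⟩
      q^ (2 + e) ⊕ B ⊕ rest ⊕ q^ 1 ⊛ (δ c ⊛ δ c)
        ≈⟨ solve 5 (λ q s y b r →
             (q :* (q :* y) :+ b :+ r) :+ q :* con 1 :*
               ((q :* s :+ q :* (q :* (q :* y))) :* (q :* s :+ q :* (q :* (q :* y)))) :=
             (q :* (q :* y) :+ b :+ r :+ q :* q :* q :* s :* s) :+
               (q :* (q :* (q :* (q :* (q :* y)))) :* s :+ q :* (q :* (q :* (q :* (q :* y)))) :* s) :+
               q :* (q :* (q :* (q :* (q :* (q :* (q :* (y :* y)))))))) ≗-refl q s y B rest ⟩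
      q^ (2 + e) ⊕ B ⊕ rest ⊕ q ⊛ q ⊛ q ⊛ s ⊛ s ⊕ (q^ (5 + e) ⊛ s ⊕ q^ (5 + e) ⊛ s) ⊕
        q ⊛ (q ⊛ (q ⊛ (q ⊛ Y)))
        ≈⟨ ⊕-cong (⊕-congʳ {x = q^ (5 + e) ⊛ s ⊕ q^ (5 + e) ⊛ s}
             (⊕-congˡ {x = q^ (2 + e) ⊕ B ⊕ rest} (⊛-congˡ {x = q ⊛ q ⊛ q ⊛ s} ([]-suc e))))
             (⊛-congˡ {x = q} (⊛-congˡ {x = q} (⊛-congˡ {x = q} (⊛-congˡ {x = q} (≗-sym power))))) ⟩
      q^ (2 + e) ⊕ B ⊕ rest ⊕ q ⊛ q ⊛ q ⊛ s ⊛ (x ⊕ y) ⊕ (q^ (5 + e) ⊛ s ⊕ q^ (5 + e) ⊛ s) ⊕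
        q^ (7 + (e + e))
        ≈⟨ solve 8 (λ q s x y b r t p →
             (q :* (q :* y) :+ b :+ r) :+ q :* q :* q :* s :* (x :+ y) :+ (t :+ t) :+ p :=
             (((q :* (q :* y) :+ q :* q :* q :* y :* s) :+ b :+ r) :+
               q :* q :* q :* x :* s) :+ t :+ t :+ p)
           ≗-refl q s x y B rest (q^ (5 + e) ⊛ s) (q^ (7 + (e + e))) ⟩
      q^ (2 + e) ⊕ q ⊛ q ⊛ q ⊛ y ⊛ s ⊕ B ⊕ rest ⊕ q ⊛ q ⊛ q ⊛ x ⊛ s ⊕
        q^ (5 + e) ⊛ s ⊕ q^ (5 + e) ⊛ s ⊕ q^ (7 + (e + e))
        ≈⟨ solve 8 (λ q s x y b r t p →
             (q :* (q :* y) :+ q :* q :* q :* y :* (con 1 :+ q :* x) :+ b :+ r :+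
               q :* q :* q :* x :* s) :+ t :+ t :+ p :=
             ((q :* (q :* y)) :* (con 1 :+ q :* (con 1 :+ q :* con 0)) :+ b :+ r :+
               q :* (q :* (q :* (x :* (s :+ q :* y))))) :+ t :+ t :+ p)
           ≗-refl q s x y B rest (q^ (5 + e) ⊛ s) (q^ (7 + (e + e))) ⟩
      q^ (2 + e) ⊛ [ 2 ]q ⊕ B ⊕ rest ⊕ q ⊛ (q ⊛ (q ⊛ (x ⊛ (s ⊕ q ⊛ y)))) ⊕
        q^ (5 + e) ⊛ s ⊕ q^ (5 + e) ⊛ s ⊕ q^ (7 + (e + e))
        ≈⟨ ⊕-congʳ {x = q^ (7 + (e + e))} (⊕-congʳ {x = q^ (5 + e) ⊛ s} (⊕-congʳ {x = q^ (5 + e) ⊛ s}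
             (⊕-congˡ {x = q^ (2 + e) ⊛ [ 2 ]q ⊕ B ⊕ rest} (⊛-congˡ {x = q} (⊛-congˡ {x = q}
               (⊛-congˡ {x = q} (⊛-congˡ {x = x} ([]-suc (suc e))))))))) ⟨
      q^ (2 + e) ⊛ [ 2 ]q ⊕ B ⊕ rest ⊕ q ⊛ (q ⊛ (q ⊛ (x ⊛ [ 2 + e ]q))) ⊕
        q^ (5 + e) ⊛ s ⊕ q^ (5 + e) ⊛ s ⊕ q^ (7 + (e + e)) ∎

-- In these cases Δ of D^(c+1) U^(a+1) D^(d+1) does not rise up to the length of
-- the word.
Singular : ℕ → ℕ → ℕ → Set
Singular c a d = c ≡ d × (a ≡ 0 ⊎ c ≡ 0)

singular? : ∀ c a d → Dec (Singular c a d)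
singular? c a d = (c ≟ d) ×-dec ((a ≟ 0) ⊎-dec (c ≟ 0))

rising-apart : ∀ c a d → ¬ c ≡ d → RisingΔ⁺ c ((a , d) ∷ [])
rising-apart c a d c≢d = subst (λ b → RisingΔ⁺ c ((b , d) ∷ [])) (+-identityʳ a)
  (climb c d a 0 (rising-pair-Δ c d c≢d))

-- With unequal end runs the climb starts at one step up; with equal ones it starts at two, from
-- `Square.rising-twice`.
rising-Δ₁ : ∀ c a d → ¬ Singular c a d → RisingΔ⁺ c ((a , d) ∷ [])
rising-Δ₁ c a d ¬sing with c ≟ d
... | no c≢d = rising-apart c a d c≢d
rising-Δ₁ c       zero    .c ¬sing | yes refl = ⊥-elim (¬sing (refl , inj₁ refl))
rising-Δ₁ zero    (suc a) .0 ¬sing | yes refl = ⊥-elim (¬sing (refl , inj₂ refl))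
rising-Δ₁ (suc e) (suc a) .(suc e) ¬sing | yes refl =
  subst (λ b → RisingΔ⁺ (suc e) ((b , suc e) ∷ [])) (+-comm a 1)
    (climb (suc e) (suc e) a 1 (strengthen (suc e) (1 , suc e) [] (rising₁ 1 _)
      (Δ-rising⁰ (suc e) ((1 , suc e) ∷ [])
        (rising-≤ (≤-reflexive (eq e)) (Square.rising-twice e))
        -- Read backwards, this cycle has runs of two and one steps down, so that its chain has
        -- unequal end runs.
        (undual ((0 , suc e) ∷ (1 , suc e) ∷ [])
          (extend (suc e) 1 (suc e , 0) [] (rising₁ (suc e) 2)
            (weaken 1 ((suc e , 0) ∷ []) (rising-apart 1 (suc e) 0 λ ())))))))
  where
  eq : ∀ e → suc e + (2 + (suc (suc e) + 0)) ≡ 2 * e + 5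
  eq = solve-∀

-- If the chain through the second block is singular, then either all steps down are single and
-- `ordered` applies, or a rotation offers the chain through the first block. If that one is
-- singular too, the cycle is exceptional.
rising₂ : ∀ a c b d → ¬ Exceptional (a , c) (b , d) → RisingCycle ((a , c) ∷ (b , d) ∷ [])
rising₂ a c b d ¬exc with singular? c b d
... | no ¬sing = extend a c (b , d) [] (rising₁ b (suc (d + c)))
  (weaken c ((b , d) ∷ []) (rising-Δ₁ c b d ¬sing))
rising₂ a c b .c ¬exc | yes (refl , inj₂ refl) with <-cmp a b
... | tri< a<b _ _ = rotate ((b , 0) ∷ []) ((a , 0) ∷ []) (ordered a<b)
... | tri≈ _ a≡b _ = ⊥-elim (¬exc (inj₁ (a≡b , refl , refl)))
... | tri> _ _ b<a = ordered b<a
rising₂ a c .0 .c ¬exc | yes (refl , inj₁ refl) with c ≟ 0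
rising₂ zero    .0 .0 .0 ¬exc | yes (refl , inj₁ refl) | yes refl =
  ⊥-elim (¬exc (inj₁ (refl , refl , refl)))
rising₂ (suc a) .0 .0 .0 ¬exc | yes (refl , inj₁ refl) | yes refl = ordered (s≤s z≤n)
... | no c≢0 = rotate ((0 , c) ∷ []) ((a , c) ∷ []) (extend 0 c (a , c) [] (rising₁ a (suc (c + c)))
  (weaken c ((a , c) ∷ []) (rising-Δ₁ c a c λ
    { (_ , inj₁ a≡0) → ¬exc (inj₂ (refl , a≡0 , refl)) ; (_ , inj₂ c≡0) → c≢0 c≡0 })))

-- Chains of five runs

Δ₂ : ℕ → ℕ → ℕ → ℕ → ℕ → Polynomial
Δ₂ c₀ a₁ c₁ a₂ c₂ = Δ c₀ ((a₁ , c₁) ∷ (a₂ , c₂) ∷ [])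

-- Fully expanded, `Δ` is a sum over the sets of runs of steps up that are kept: each kept run
-- contributes its window, each stretch of runs of steps down merged between them a `δ`. This does
-- not depend on the direction of reading.
Δ₂-reverse : ∀ c₀ a₁ c₁ a₂ c₂ → Δ₂ c₀ a₁ c₁ a₂ c₂ ≗ Δ₂ c₂ a₂ c₁ a₁ c₀
Δ₂-reverse c₀ a₁ c₁ a₂ c₂ = begin
  Δ₂ c₀ a₁ c₁ a₂ c₂
    ≈⟨ ⊕-cong (⊕-cong (run (eq₁ c₀ c₁ c₂)) (⊛-congʳ {x = δ c₂} (⊛-congˡ {x = x₂} (run (eq₂ c₀ c₁)))))
         (⊛-congˡ {x = x₁ ⊛ δ c₀} (⊕-congʳ {x = x₂ ⊛ δ c₁ ⊛ δ c₂} (run (eq₂ c₁ c₂)))) ⟩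
  (δ (suc (suc (c₂ + c₁) + c₀)) ⊕ x₂ ⊛ δ (suc (c₁ + c₀)) ⊛ δ c₂) ⊕
    x₁ ⊛ δ c₀ ⊛ (δ (suc (c₂ + c₁)) ⊕ x₂ ⊛ δ c₁ ⊛ δ c₂)
    ≈⟨ solve 8 (λ x₁ x₂ d₀ d₁ d₂ d₀₁ d₁₂ d →
         (d :+ x₂ :* d₀₁ :* d₂) :+ x₁ :* d₀ :* (d₁₂ :+ x₂ :* d₁ :* d₂) :=
         (d :+ x₁ :* d₁₂ :* d₀) :+ x₂ :* d₂ :* (d₀₁ :+ x₁ :* d₁ :* d₀))
       ≗-refl x₁ x₂ (δ c₀) (δ c₁) (δ c₂) (δ (suc (c₁ + c₀))) (δ (suc (c₂ + c₁)))
       (δ (suc (suc (c₂ + c₁) + c₀))) ⟩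
  Δ₂ c₂ a₂ c₁ a₁ c₀ ∎
  where
  open import Relation.Binary.Reasoning.Setoid (CommutativeSemiring.setoid polynomials)
  x₁ = [ suc a₁ ]q
  x₂ = [ suc a₂ ]q
  run : ∀ {m n} → m ≡ n → δ m ≗ δ n
  run refl _ = refl
  eq₁ : ∀ a b c → suc (suc (a + b) + c) ≡ suc (suc (c + b) + a)
  eq₁ = solve-∀
  eq₂ : ∀ a b → suc (a + b) ≡ suc (b + a)
  eq₂ = solve-∀

width₂ : ℕ → ℕ → ℕ → ℕ → ℕ → ℕ
width₂ c₀ a₁ c₁ a₂ c₂ = width c₀ ((a₁ , c₁) ∷ (a₂ , c₂) ∷ [])

width₂-reverse : ∀ c₀ a₁ c₁ a₂ c₂ → width₂ c₀ a₁ c₁ a₂ c₂ ≡ width₂ c₂ a₂ c₁ a₁ c₀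
width₂-reverse = eq
  where
  eq : ∀ c₀ a₁ c₁ a₂ c₂ → suc c₀ + (suc a₁ + (suc c₁ + (suc a₂ + (suc c₂ + 0)))) ≡
                          suc c₂ + (suc a₂ + (suc c₁ + (suc a₁ + (suc c₀ + 0))))
  eq = solve-∀

Weak₂ Strong₂ : ℕ → ℕ → ℕ → ℕ → ℕ → Set
Weak₂   c₀ a₁ c₁ a₂ c₂ = RisingΔ  c₀ ((a₁ , c₁) ∷ (a₂ , c₂) ∷ [])
Strong₂ c₀ a₁ c₁ a₂ c₂ = RisingΔ⁺ c₀ ((a₁ , c₁) ∷ (a₂ , c₂) ∷ [])

weak₂-reverse : ∀ c₀ a₁ c₁ a₂ c₂ → Weak₂ c₂ a₂ c₁ a₁ c₀ → Weak₂ c₀ a₁ c₁ a₂ c₂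
weak₂-reverse c₀ a₁ c₁ a₂ c₂ r = subst (λ n → Rising n (Δ₂ c₀ a₁ c₁ a₂ c₂))
  (width₂-reverse c₂ a₂ c₁ a₁ c₀) (rising-≗ (Δ₂-reverse c₂ a₂ c₁ a₁ c₀) r)

strong₂-reverse : ∀ c₀ a₁ c₁ a₂ c₂ → Strong₂ c₂ a₂ c₁ a₁ c₀ → Strong₂ c₀ a₁ c₁ a₂ c₂
strong₂-reverse c₀ a₁ c₁ a₂ c₂ r = subst (λ n → Rising (suc n) (Δ₂ c₀ a₁ c₁ a₂ c₂))
  (width₂-reverse c₂ a₂ c₁ a₁ c₀) (rising-≗ (Δ₂-reverse c₂ a₂ c₁ a₁ c₀) r)

weaken₂ : ∀ c₀ a₁ c₁ a₂ c₂ → Strong₂ c₀ a₁ c₁ a₂ c₂ → Weak₂ c₀ a₁ c₁ a₂ c₂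
weaken₂ c₀ a₁ c₁ a₂ c₂ = weaken c₀ ((a₁ , c₁) ∷ (a₂ , c₂) ∷ [])

strengthen₂ : ∀ c₀ a₁ c₁ a₂ c₂ → ¬ (c₁ ≡ suc (c₂ + c₀) × a₁ ≡ 0 × a₂ ≡ 0) →
              Weak₂ c₀ a₁ c₁ a₂ c₂ → Strong₂ c₀ a₁ c₁ a₂ c₂
strengthen₂ c₀ a₁ c₁ a₂ c₂ ¬exc =
  strengthen c₀ (a₁ , c₁) ((a₂ , c₂) ∷ []) (rising₂ a₁ c₁ a₂ (suc (c₂ + c₀)) λ
    { (inj₁ (_ , _ , ())) ; (inj₂ exc) → ¬exc exc })

δ₀-rising : ∀ {d f} → Rising d f → Rising (4 + d) (δ 0 ⊛ f)
δ₀-rising {f = f} r = rising-≗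
  (solve 2 (λ q f → q :* (q :* f) := (q :* con 0 :+ q :* (q :* con 1)) :* f) ≗-refl q f)
  (rising-q (rising-q r))

-- The weak bound 2 of `rising-Δ₀` is made up for by `δ 0`, which is `q^2` and gains four units
-- instead of one. With the shift by `q^(a+1)` this makes `2 a + 8`, to be compared with the width
-- `6 + a + b`; hence the condition on `b`.
ones-step : ∀ a b → b ≤ 2 + a → Strong₂ 0 a 0 b 0 → Strong₂ 0 (suc a) 0 b 0
ones-step a b b≤ r = strengthen₂ 0 (suc a) 0 b 0 (λ ())
  (rising-≗ (≗-sym (Δ-suc 0 a 0 ((b , 0) ∷ []))) (rising-⊕
    (rising-≤ (≤-reflexive (eq a b)) r)
    (rising-q^ (suc a) bound (δ₀-rising (rising-Δ₀ b)))))
  where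
  eq : ∀ a b → 1 + (suc (suc a) + (1 + (suc b + (1 + 0)))) ≡
               suc (1 + (suc a + (1 + (suc b + (1 + 0)))))
  eq = solve-∀
  bound : 1 + (suc (suc a) + (1 + (suc b + (1 + 0)))) ≤ 2 * suc a + (4 + 2)
  bound = ≤-trans (≤-reflexive (eq₁ a b)) (≤-trans (+-monoʳ-≤ (6 + a) b≤) (≤-reflexive (eq₂ a)))
    where
    eq₁ : ∀ a b → 1 + (suc (suc a) + (1 + (suc b + (1 + 0)))) ≡ 6 + a + b
    eq₁ = solve-∀
    eq₂ : ∀ a → 6 + a + (2 + a) ≡ 2 * suc a + (4 + 2)
    eq₂ = solve-∀

-- The two runs grow in turn, exchanged by reversal, so that they never differ by more than one.
ones-diagonal : ∀ n → Strong₂ 0 n 0 n 0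
ones-diagonal zero    = strengthen₂ 0 0 0 0 0 (λ ())
  (rising-≗ (Δ-first 0 0 ((0 , 0) ∷ [])) (rising-⊕
    (rising-Δ₁ 1 0 0 λ ())
    (rising-≤ (s≤s (s≤s (s≤s (s≤s (s≤s z≤n))))) (δ₀-rising (rising-Δ₀ 0)))))
ones-diagonal (suc n) = ones-step n (suc n) (n≤1+n (suc n))
  (strong₂-reverse 0 n 0 (suc n) 0 (ones-step n n (m≤n+m n 2) (ones-diagonal n)))

ones-above : ∀ k n → Strong₂ 0 (k + n) 0 n 0
ones-above zero    n = ones-diagonal n
ones-above (suc k) n =
  ones-step (k + n) n (≤-trans (m≤n+m n k) (m≤n+m (k + n) 2)) (ones-above k n)

strong-ones : ∀ a b → Strong₂ 0 a 0 b 0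
strong-ones a b with ≤-total b a
... | inj₁ b≤a = subst (λ a → Strong₂ 0 a 0 b 0) (m∸n+n≡m b≤a) (ones-above (a ∸ b) b)
... | inj₂ a≤b = strong₂-reverse 0 a 0 b 0
  (subst (λ b → Strong₂ 0 b 0 a 0) (m∸n+n≡m a≤b) (ones-above (b ∸ a) a))

-- At `a = 0` the polynomial is `q [7] + q^2 [5] + q^4`, three intervals centred at `q^4`.
strong-two : ∀ a → Strong₂ 0 a 0 0 1
strong-two zero    = strengthen₂ 0 0 0 0 1 (λ ()) (rising-≗ (solve 1 (λ q →
    let one = con 1 :+ q :* con 0
        d₁ = q :* con 0 :+ q :* (q :* con 1)
        d₂ = q :* one :+ q :* (q :* (q :* con 1))
        b₃ = con 1 :+ q :* (con 1 :+ q :* one)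
        b₅ = con 1 :+ q :* (con 1 :+ q :* b₃)
        d₃ = q :* (con 1 :+ q :* one) :+ q :* (q :* (q :* (q :* con 1)))
        d₄ = q :* b₃ :+ q :* (q :* (q :* (q :* (q :* con 1))))
        b₇ = con 1 :+ q :* (con 1 :+ q :* b₅)
    in q :* con 1 :* b₇ :+ q :* (q :* con 1) :* b₅ :+ q :* (q :* (q :* (q :* con 1))) :=
       (d₄ :+ one :* d₂ :* d₂) :+ one :* d₁ :* (d₃ :+ one :* d₁ :* d₂)) ≗-refl q)
  (rising-⊕ (rising-⊕ (rising-interval 1 7 (m≤m+n 7 2)) (rising-interval 2 5 (m≤m+n 7 2)))
    (rising-power 4 (m≤m+n 6 2))))
strong-two (suc a) = strengthen₂ 0 (suc a) 0 0 1 (λ ()) (Δ-step 0 a 0 ((0 , 1) ∷ [])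
  (strong-two a) (weaken 0 ((0 , 1) ∷ []) (rising-Δ₁ 0 0 1 λ ())))

-- For k = 0 and k = 2 + e, both runs of ups are blocked. The summand q^(2+e) of
-- Δ-single is too low; its product with δ x becomes an interval ending high enough
-- when combined with part of the other products.
weak-sandwich : ∀ e k → Weak₂ (k + suc e) 0 (suc e) 0 (suc e)
weak-sandwich e k = Δ-rising⁰ x L (rising-≗ (Δ-first x c ((0 , c) ∷ [])) (rising-⊕
    (rising-≤ (≤-by 1 (eq₁ x c))
      (rising-Δ₁ (suc (x + c)) 0 c λ (x≡c , _) → m≢1+n+m c (sym x≡c)))
    (rising-≗ (≗-sym product) (rising-⊕ (rising-⊕ (rising-⊕ (rising-⊕
      (rising-interval (3 + e) (x + (e + 5)) (≤-by (4 + e) (eq₂ e k)))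
      (rising-interval (3 + x) e (≤-by k (eq₃ e k))))
      (rising-≤ (≤-reflexive (eq₄ e k)) (rising-q (rising-q (rising-[] x (≤-by 1 (eq₅ e x))
        (rising-[]₁ (4 + (e + e))))))))
      (rising-q^ (2 + x) (≤-by (2 + x) (eq₆ e k)) (rising-power (2 + e) ≤-refl)))
      (rising-δ x (≤-reflexive (eq₇ e k)) rising-rest)))))
  -- Read backwards, the cycle with one more step up has only single steps down, where `strong-ones`
  -- is available.
  (undual ((0 , x) ∷ L) (rotate ((x , 0) ∷ []) ((c , 0) ∷ (c , 0) ∷ [])
    (extend x 0 (c , 0) ((c , 0) ∷ [])
      (rising₂ c 0 c 1 λ { (inj₁ (_ , _ , ())) ; (inj₂ (() , _)) })
      (weaken 0 ((c , 0) ∷ (c , 0) ∷ []) (strong-ones c c)))))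
  where
  open Square e using (c; y; rest; rising-rest; Δ-single)
  open import Relation.Binary.Reasoning.Setoid (CommutativeSemiring.setoid polynomials)
  x = k + suc e
  L = (0 , c) ∷ (0 , c) ∷ []
  X = [ x ]q
  Q = q^ x
  E = [ e ]q
  F = [ e + 5 ]q
  B = [ 5 + (e + e) ]q
  eq₁ : ∀ x c → x + (1 + (suc c + (1 + (suc c + 0)))) + 1 ≡ suc (suc (suc (x + c)) + (1 + (suc c + 0)))
  eq₁ = solve-∀
  eq₂ : ∀ e k → suc (k + suc e + (1 + (suc (suc e) + (1 + (suc (suc e) + 0))))) + (4 + e) ≡
                k + suc e + (e + 5) + 2 * (3 + e)
  eq₂ = solve-∀
  eq₃ : ∀ e k → suc (k + suc e + (1 + (suc (suc e) + (1 + (suc (suc e) + 0))))) + k ≡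
                e + 2 * (3 + (k + suc e))
  eq₃ = solve-∀
  eq₄ : ∀ e k → k + suc e + (1 + (suc (suc e) + (1 + (suc (suc e) + 0)))) ≡
                4 + (k + suc e + (2 + (e + e)))
  eq₄ = solve-∀
  eq₅ : ∀ e x → suc (x + (2 + (e + e))) + 1 ≡ x + (4 + (e + e))
  eq₅ = solve-∀
  eq₆ : ∀ e k → k + suc e + (1 + (suc (suc e) + (1 + (suc (suc e) + 0)))) + (2 + (k + suc e)) ≡
                2 * (2 + (k + suc e)) + 2 * (2 + e)
  eq₆ = solve-∀
  eq₇ : ∀ e k → k + suc e + (1 + (suc (suc e) + (1 + (suc (suc e) + 0)))) ≡
                suc (k + suc e) + (2 * e + 5)
  eq₇ = solve-∀
  eq₈ : ∀ e → 5 + (e + e) ≡ e + (e + 5)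
  eq₈ = solve-∀
  product : δ x ⊛ Δ c ((0 , c) ∷ []) ≗
    q^ (3 + e) ⊛ [ x + (e + 5) ]q ⊕ q^ (3 + x) ⊛ E ⊕ q ⊛ (q ⊛ (X ⊛ B)) ⊕ q^ (2 + x) ⊛ q^ (2 + e) ⊕
    δ x ⊛ rest
  product = begin
    δ x ⊛ Δ c ((0 , c) ∷ [])
      ≈⟨ ⊛-congˡ {x = δ x} Δ-single ⟩
    δ x ⊛ (q^ (2 + e) ⊕ q ⊛ B ⊕ rest)
      ≈⟨ solve 6 (λ q X Q y b r →
           (q :* X :+ q :* (q :* Q)) :* (q :* (q :* y) :+ q :* b :+ r) :=
           q :* q :* q :* Q :* b :+ (q :* q :* q :* X :* y :+ q :* q :* X :* b :+
             q :* q :* q :* q :* Q :* y :+ (q :* X :+ q :* (q :* Q)) :* r)) ≗-refl q X Q y B rest ⟩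
    q ⊛ q ⊛ q ⊛ Q ⊛ B ⊕ (q ⊛ q ⊛ q ⊛ X ⊛ y ⊕ q ⊛ q ⊛ X ⊛ B ⊕ q ⊛ q ⊛ q ⊛ q ⊛ Q ⊛ y ⊕ δ x ⊛ rest)
      ≈⟨ ⊕-congʳ {x = q ⊛ q ⊛ q ⊛ X ⊛ y ⊕ q ⊛ q ⊛ X ⊛ B ⊕ q ⊛ q ⊛ q ⊛ q ⊛ Q ⊛ y ⊕ δ x ⊛ rest}
           (⊛-congˡ {x = q ⊛ q ⊛ q ⊛ Q} (≗-trans (λ i → cong (λ n → [ n ]q i) (eq₈ e)) ([]-+ e (e + 5)))) ⟩
    q ⊛ q ⊛ q ⊛ Q ⊛ (E ⊕ y ⊛ F) ⊕
      (q ⊛ q ⊛ q ⊛ X ⊛ y ⊕ q ⊛ q ⊛ X ⊛ B ⊕ q ⊛ q ⊛ q ⊛ q ⊛ Q ⊛ y ⊕ δ x ⊛ rest)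
      ≈⟨ solve 8 (λ q X Q y b E F r →
           q :* q :* q :* Q :* (E :+ y :* F) :+
             (q :* q :* q :* X :* y :+ q :* q :* X :* b :+ q :* q :* q :* q :* Q :* y :+ r) :=
           q :* (q :* (q :* y)) :* (X :+ Q :* F) :+ q :* (q :* (q :* Q)) :* E :+
             q :* (q :* (X :* b)) :+ q :* (q :* Q) :* (q :* (q :* y)) :+ r)
         ≗-refl q X Q y B E F (δ x ⊛ rest) ⟩
    q^ (3 + e) ⊛ (X ⊕ Q ⊛ F) ⊕ q^ (3 + x) ⊛ E ⊕ q ⊛ (q ⊛ (X ⊛ B)) ⊕ q^ (2 + x) ⊛ q^ (2 + e) ⊕
      δ x ⊛ rest
      ≈⟨ ⊕-congʳ {x = δ x ⊛ rest} (⊕-congʳ {x = q^ (2 + x) ⊛ q^ (2 + e)}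
           (⊕-congʳ {x = q ⊛ (q ⊛ (X ⊛ B))} (⊕-congʳ {x = q^ (3 + x) ⊛ E}
             (⊛-congˡ {x = q^ (3 + e)} ([]-+ x (e + 5)))))) ⟨
    q^ (3 + e) ⊛ [ x + (e + 5) ]q ⊕ q^ (3 + x) ⊛ E ⊕ q ⊛ (q ⊛ (X ⊛ B)) ⊕ q^ (2 + x) ⊛ q^ (2 + e) ⊕
      δ x ⊛ rest ∎

-- Peeling off the run a₁ would lead to a singular shorter chain or pass through
-- an exceptional cycle.
Blocked : ℕ → ℕ → ℕ → ℕ → ℕ → Set
Blocked c₀ a₁ c₁ a₂ c₂ = Singular c₁ a₂ c₂ ⊎ (c₂ ≡ suc (c₀ + c₁) × a₂ ≡ 0) ⊎
                         (c₁ ≡ suc (c₂ + c₀) × a₂ ≡ 0 × a₁ ≢ 0)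

blocked? : ∀ c₀ a₁ c₁ a₂ c₂ → Dec (Blocked c₀ a₁ c₁ a₂ c₂)
blocked? c₀ a₁ c₁ a₂ c₂ = singular? c₁ a₂ c₂ ⊎-dec
  ((c₂ ≟ suc (c₀ + c₁)) ×-dec (a₂ ≟ 0)) ⊎-dec
  ((c₁ ≟ suc (c₂ + c₀)) ×-dec (a₂ ≟ 0) ×-dec ¬? (a₁ ≟ 0))

peel₂ : ∀ c₀ a₁ c₁ a₂ c₂ → ¬ Blocked c₀ a₁ c₁ a₂ c₂ → Weak₂ c₀ a₁ c₁ a₂ c₂
peel₂ c₀ a₁ c₁ a₂ c₂ ¬b = peel⁺ c₀ a₁ c₁ ((a₂ , c₂) ∷ [])
  (rising-Δ₁ (suc (c₀ + c₁)) a₂ c₂ λ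
    { (c≡ , inj₁ a₂≡0) → ¬b (inj₂ (inj₁ (sym c≡ , a₂≡0))) })
  (rising-Δ₁ c₁ a₂ c₂ λ sing → ¬b (inj₁ sing))
  (λ b b<a₁ → rising₂ b c₁ a₂ (suc (c₂ + c₀)) λ
    { (inj₁ (_ , _ , ()))
    ; (inj₂ (c≡ , _ , a₂≡0)) → ¬b (inj₂ (inj₂ (c≡ , a₂≡0 ,
        λ a₁≡0 → n≮0 (subst (b <_) a₁≡0 b<a₁)))) })

weak-double : ∀ c → Weak₂ (suc (c + c)) 0 c 0 c
weak-double zero    = weak₂-reverse 1 0 0 0 0 (weaken₂ 0 0 0 0 1 (strong-two 0))
weak-double (suc e) = weak-sandwich e (2 + e)

-- By reversal, only chains blocked from both ends remain. The compatible pairs of reasons leave the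
-- families of `strong-ones`, `strong-two`, `weak-sandwich` and `weak-double`; the other pairs
-- contradict each other.
weak₂ : ∀ c₀ a₁ c₁ a₂ c₂ → Weak₂ c₀ a₁ c₁ a₂ c₂
weak₂ c₀ a₁ c₁ a₂ c₂ with blocked? c₀ a₁ c₁ a₂ c₂ | blocked? c₂ a₂ c₁ a₁ c₀
... | no ¬b | _     = peel₂ c₀ a₁ c₁ a₂ c₂ ¬b
... | yes _ | no ¬b = weak₂-reverse c₀ a₁ c₁ a₂ c₂ (peel₂ c₂ a₂ c₁ a₁ c₀ ¬b)
... | yes (inj₁ (refl , inj₁ refl)) | yes (inj₁ (refl , inj₁ refl)) = same c₁
  where
  same : ∀ c → Weak₂ c 0 c 0 c
  same zero    = weaken₂ 0 0 0 0 0 (strong-ones 0 0)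
  same (suc e) = weak-sandwich e 0
... | yes (inj₁ (refl , inj₁ refl)) | yes (inj₁ (refl , inj₂ refl)) =
  weaken₂ 0 a₁ 0 0 0 (strong-ones a₁ 0)
... | yes (inj₁ (refl , inj₂ refl)) | yes (inj₁ (refl , _)) =
  weaken₂ 0 a₁ 0 a₂ 0 (strong-ones a₁ a₂)
... | yes (inj₁ (refl , inj₁ refl)) | yes (inj₂ (inj₁ (refl , refl))) = weak-double c₁
... | yes (inj₁ (refl , inj₂ refl)) | yes (inj₂ (inj₁ (refl , refl))) =
  weak₂-reverse 1 0 0 a₂ 0 (weaken₂ 0 a₂ 0 0 1 (strong-two a₂))
... | yes (inj₁ (refl , _)) | yes (inj₂ (inj₂ (c₁≡ , _))) = ⊥-elim (m≢1+n+m c₁ c₁≡)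
... | yes (inj₂ (inj₁ (refl , refl))) | yes (inj₁ (refl , inj₁ refl)) =
  weak₂-reverse c₁ 0 c₁ 0 (suc (c₁ + c₁)) (weak-double c₁)
... | yes (inj₂ (inj₁ (refl , refl))) | yes (inj₁ (refl , inj₂ refl)) =
  weaken₂ 0 a₁ 0 0 1 (strong-two a₁)
... | yes (inj₂ (inj₁ (c₂≡ , _))) | yes (inj₂ (inj₁ (c₀≡ , _))) =
  ⊥-elim (<-asym (≤-trans (s≤s (m≤m+n c₀ c₁)) (≤-reflexive (sym c₂≡)))
    (≤-trans (s≤s (m≤m+n c₂ c₁)) (≤-reflexive (sym c₀≡))))
... | yes (inj₂ (inj₁ (_ , a₂≡0))) | yes (inj₂ (inj₂ (_ , _ , a₂≢0))) = ⊥-elim (a₂≢0 a₂≡0)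
... | yes (inj₂ (inj₂ (c₁≡ , _))) | yes (inj₁ (refl , _)) = ⊥-elim (m≢1+n+m c₁ c₁≡)
... | yes (inj₂ (inj₂ (_ , _ , a₁≢0))) | yes (inj₂ (inj₁ (_ , a₁≡0))) = ⊥-elim (a₁≢0 a₁≡0)
... | yes (inj₂ (inj₂ (_ , _ , a₁≢0))) | yes (inj₂ (inj₂ (_ , a₁≡0 , _))) = ⊥-elim (a₁≢0 a₁≡0)

-- Cycles of three or more blocks

-- The merged cycle can be exceptional only if `c₂` equals `c₃ + c₁ + 1`. After one rotation the
-- same obstruction would make `c₃` greater than `c₂`, so one of the two positions is free.
rising₃ : ∀ a₁ c₁ a₂ c₂ a₃ c₃ → RisingCycle ((a₁ , c₁) ∷ (a₂ , c₂) ∷ (a₃ , c₃) ∷ [])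
rising₃ a₁ c₁ a₂ c₂ a₃ c₃ with c₂ ≟ suc (c₃ + c₁)
... | no c₂≢ = extend a₁ c₁ (a₂ , c₂) ((a₃ , c₃) ∷ [])
  (rising₂ a₂ c₂ a₃ (suc (c₃ + c₁)) λ { (inj₁ (_ , _ , ())) ; (inj₂ (c₂≡ , _)) → c₂≢ c₂≡ })
  (weak₂ c₁ a₂ c₂ a₃ c₃)
... | yes c₂≡ = rotate ((a₂ , c₂) ∷ (a₃ , c₃) ∷ []) ((a₁ , c₁) ∷ [])
  (extend a₂ c₂ (a₃ , c₃) ((a₁ , c₁) ∷ [])
  (rising₂ a₃ c₃ a₁ (suc (c₁ + c₂)) λ
    { (inj₁ (_ , _ , ()))
    ; (inj₂ (c₃≡ , _)) → <-asym (≤-trans (s≤s (m≤m+n c₃ c₁)) (≤-reflexive (sym c₂≡)))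
        (≤-trans (s≤s (m≤n+m c₂ c₁)) (≤-reflexive (sym c₃≡))) })
  (weak₂ c₂ a₃ c₃ a₁ c₁))

strong₂ : ∀ c₀ a₁ c₁ a₂ c₂ → c₁ ≤ c₀ → Strong₂ c₀ a₁ c₁ a₂ c₂
strong₂ c₀ a₁ c₁ a₂ c₂ c₁≤c₀ = strengthen₂ c₀ a₁ c₁ a₂ c₂
  (λ (c₁≡ , _) → <-irrefl refl (≤-trans (s≤s (≤-trans c₁≤c₀ (m≤n+m c₀ c₂))) (≤-reflexive (sym c₁≡))))
  (weak₂ c₀ a₁ c₁ a₂ c₂)

Δ₃-reverse : ∀ c₀ a₁ c₁ a₂ c₂ a₃ c₃ →
  Δ c₀ ((a₁ , c₁) ∷ (a₂ , c₂) ∷ (a₃ , c₃) ∷ []) ≗ Δ c₃ ((a₃ , c₂) ∷ (a₂ , c₁) ∷ (a₁ , c₀) ∷ [])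
Δ₃-reverse c₀ a₁ c₁ a₂ c₂ a₃ c₃ = begin
  ((δ (suc (suc (suc (c₀ + c₁) + c₂) + c₃)) ⊕ x₃ ⊛ δ (suc (suc (c₀ + c₁) + c₂)) ⊛ d₃) ⊕
    x₂ ⊛ δ (suc (c₀ + c₁)) ⊛ (δ (suc (c₂ + c₃)) ⊕ x₃ ⊛ d₂ ⊛ d₃)) ⊕
  x₁ ⊛ d₀ ⊛ ((δ (suc (suc (c₁ + c₂) + c₃)) ⊕ x₃ ⊛ δ (suc (c₁ + c₂)) ⊛ d₃) ⊕
    x₂ ⊛ d₁ ⊛ (δ (suc (c₂ + c₃)) ⊕ x₃ ⊛ d₂ ⊛ d₃))
    ≈⟨ solve 13 (λ x₁ x₂ x₃ d₀ d₁ d₂ d₃ d₀₁ d₁₂ d₂₃ d₀₁₂ d₁₂₃ d →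
         ((d :+ x₃ :* d₀₁₂ :* d₃) :+ x₂ :* d₀₁ :* (d₂₃ :+ x₃ :* d₂ :* d₃)) :+
         x₁ :* d₀ :* ((d₁₂₃ :+ x₃ :* d₁₂ :* d₃) :+ x₂ :* d₁ :* (d₂₃ :+ x₃ :* d₂ :* d₃)) :=
         ((d :+ x₁ :* d₁₂₃ :* d₀) :+ x₂ :* d₂₃ :* (d₀₁ :+ x₁ :* d₁ :* d₀)) :+
         x₃ :* d₃ :* ((d₀₁₂ :+ x₁ :* d₁₂ :* d₀) :+ x₂ :* d₂ :* (d₀₁ :+ x₁ :* d₁ :* d₀)))
       ≗-refl x₁ x₂ x₃ d₀ d₁ d₂ d₃ (δ (suc (c₀ + c₁))) (δ (suc (c₁ + c₂))) (δ (suc (c₂ + c₃)))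
       (δ (suc (suc (c₀ + c₁) + c₂))) (δ (suc (suc (c₁ + c₂) + c₃)))
       (δ (suc (suc (suc (c₀ + c₁) + c₂) + c₃))) ⟩
  ((δ (suc (suc (suc (c₀ + c₁) + c₂) + c₃)) ⊕ x₁ ⊛ δ (suc (suc (c₁ + c₂) + c₃)) ⊛ d₀) ⊕
    x₂ ⊛ δ (suc (c₂ + c₃)) ⊛ (δ (suc (c₀ + c₁)) ⊕ x₁ ⊛ d₁ ⊛ d₀)) ⊕
  x₃ ⊛ d₃ ⊛ ((δ (suc (suc (c₀ + c₁) + c₂)) ⊕ x₁ ⊛ δ (suc (c₁ + c₂)) ⊛ d₀) ⊕
    x₂ ⊛ d₂ ⊛ (δ (suc (c₀ + c₁)) ⊕ x₁ ⊛ d₁ ⊛ d₀))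
    ≡⟨ runs (eq₄ c₀ c₁ c₂ c₃) (eq₃ c₁ c₂ c₃) (eq₂ c₂ c₃) (eq₂ c₀ c₁) (eq₃ c₀ c₁ c₂) (eq₂ c₁ c₂) ⟩
  Δ c₃ ((a₃ , c₂) ∷ (a₂ , c₁) ∷ (a₁ , c₀) ∷ []) ∎
  where
  open import Relation.Binary.Reasoning.Setoid (CommutativeSemiring.setoid polynomials)
  x₁ = [ suc a₁ ]q
  x₂ = [ suc a₂ ]q
  x₃ = [ suc a₃ ]q
  d₀ = δ c₀
  d₁ = δ c₁
  d₂ = δ c₂
  d₃ = δ c₃
  eq₂ : ∀ a b → suc (a + b) ≡ suc (b + a)
  eq₂ = solve-∀
  eq₃ : ∀ a b c → suc (suc (a + b) + c) ≡ suc (suc (c + b) + a)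
  eq₃ = solve-∀
  eq₄ : ∀ a b c d → suc (suc (suc (a + b) + c) + d) ≡ suc (suc (suc (d + c) + b) + a)
  eq₄ = solve-∀
  runs : ∀ {m m′ n n′ o o′ p p′ r r′ t t′} →
    m ≡ m′ → n ≡ n′ → o ≡ o′ → p ≡ p′ → r ≡ r′ → t ≡ t′ →
    ((δ m ⊕ x₁ ⊛ δ n ⊛ d₀) ⊕ x₂ ⊛ δ o ⊛ (δ p ⊕ x₁ ⊛ d₁ ⊛ d₀)) ⊕
      x₃ ⊛ d₃ ⊛ ((δ r ⊕ x₁ ⊛ δ t ⊛ d₀) ⊕ x₂ ⊛ d₂ ⊛ (δ p ⊕ x₁ ⊛ d₁ ⊛ d₀)) ≡
    ((δ m′ ⊕ x₁ ⊛ δ n′ ⊛ d₀) ⊕ x₂ ⊛ δ o′ ⊛ (δ p′ ⊕ x₁ ⊛ d₁ ⊛ d₀)) ⊕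
      x₃ ⊛ d₃ ⊛ ((δ r′ ⊕ x₁ ⊛ δ t′ ⊛ d₀) ⊕ x₂ ⊛ d₂ ⊛ (δ p′ ⊕ x₁ ⊛ d₁ ⊛ d₀))
  runs refl refl refl refl refl refl = refl

-- Peeling leaves two chains whose second run of steps down is `c₂` and whose first is `c₁` or
-- longer, as `strong₂` requires. In the opposite order of `c₁` and `c₂` the chain is reversed
-- first.
strong-ordered : ∀ c₀ a₁ c₁ a₂ c₂ a₃ c₃ → c₂ ≤ c₁ →
                 RisingΔ⁺ c₀ ((a₁ , c₁) ∷ (a₂ , c₂) ∷ (a₃ , c₃) ∷ [])
strong-ordered c₀ a₁ c₁ a₂ c₂ a₃ c₃ c₂≤c₁ =
  strengthen c₀ (a₁ , c₁) L (rising₃ a₁ c₁ a₂ c₂ a₃ (suc (c₃ + c₀))) (peel⁺ c₀ a₁ c₁ L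
    (strong₂ (suc (c₀ + c₁)) a₂ c₂ a₃ c₃ (m≤n⇒m≤1+n (≤-trans c₂≤c₁ (m≤n+m c₁ c₀))))
    (strong₂ c₁ a₂ c₂ a₃ c₃ c₂≤c₁)
    (λ b _ → rising₃ b c₁ a₂ c₂ a₃ (suc (c₃ + c₀))))
  where L = (a₂ , c₂) ∷ (a₃ , c₃) ∷ []

strong₃ : ∀ c₀ a₁ c₁ a₂ c₂ a₃ c₃ → RisingΔ⁺ c₀ ((a₁ , c₁) ∷ (a₂ , c₂) ∷ (a₃ , c₃) ∷ [])
strong₃ c₀ a₁ c₁ a₂ c₂ a₃ c₃ with ≤-total c₂ c₁
... | inj₁ c₂≤c₁ = strong-ordered c₀ a₁ c₁ a₂ c₂ a₃ c₃ c₂≤c₁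
... | inj₂ c₁≤c₂ = subst (λ n → Rising (suc n) (Δ c₀ ((a₁ , c₁) ∷ (a₂ , c₂) ∷ (a₃ , c₃) ∷ [])))
  (eq c₀ a₁ c₁ a₂ c₂ a₃ c₃)
  (rising-≗ (Δ₃-reverse c₃ a₃ c₂ a₂ c₁ a₁ c₀) (strong-ordered c₃ a₃ c₂ a₂ c₁ a₁ c₀ c₁≤c₂))
  where
  eq : ∀ c₀ a₁ c₁ a₂ c₂ a₃ c₃ →
    suc c₃ + (suc a₃ + (suc c₂ + (suc a₂ + (suc c₁ + (suc a₁ + (suc c₀ + 0)))))) ≡
    suc c₀ + (suc a₁ + (suc c₁ + (suc a₂ + (suc c₂ + (suc a₃ + (suc c₃ + 0))))))
  eq = solve-∀

length-merge : ∀ f b L → length (merge f b L) ≡ suc (length L)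
length-merge f b []       = refl
length-merge f b (b′ ∷ L) = cong suc (length-merge f b′ L)

-- Merging keeps at least three blocks, and such cycles are never exceptional, so the induction is
-- regular from here on. Cycles rest on cycles and chains with one block fewer; chains rest on
-- shorter chains and on cycles with equally many blocks.
rising-long : ∀ n L → length L ≡ 3 + n → RisingCycle L
strong-long : ∀ n f L → length L ≡ 3 + n → RisingΔ⁺ f L

rising-long zero ((a₁ , c₁) ∷ (a₂ , c₂) ∷ (a₃ , c₃) ∷ []) _ = rising₃ a₁ c₁ a₂ c₂ a₃ c₃
rising-long (suc n) ((a , f) ∷ b ∷ L) e = extend a f b L
  (rising-long n (merge f b L) (trans (length-merge f b L) (suc-injective e)))
  (weaken f (b ∷ L) (strong-long n f (b ∷ L) (suc-injective e)))

strong-long zero f ((a₁ , c₁) ∷ (a₂ , c₂) ∷ (a₃ , c₃) ∷ []) _ = strong₃ f a₁ c₁ a₂ c₂ a₃ c₃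
strong-long (suc n) f ((a , g) ∷ L) e = strengthen f (a , g) L
  (rising-long (suc n) (merge f (a , g) L) (trans (length-merge f (a , g) L) e))
  (peel⁺ f a g L (strong-long n (suc (f + g)) L (suc-injective e))
    (strong-long n g L (suc-injective e))
    (λ b _ → rising-long (suc n) (merge f (b , g) L) (trans (length-merge f (b , g) L) e)))

open import Data.Fin.Base using (Fin; zero; suc; inject₁; fromℕ)

-- Lower ideals as bit strings

-- Counting by a Boolean test allows tests that agree pointwise to be exchanged, whatever proofs the
-- decisions carry.
tally : {A : Set} → (A → Bool) → List A → ℕ
tally p []       = 0
tally p (x ∷ xs) = if p x then suc (tally p xs) else tally p xs

tally-++ : ∀ {A : Set} (p : A → Bool) xs ys → tally p (xs ++ ys) ≡ tally p xs + tally p ys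
tally-++ p []       ys = refl
tally-++ p (x ∷ xs) ys with p x
... | true  = cong suc (tally-++ p xs ys)
... | false = tally-++ p xs ys

tally-map : ∀ {A B : Set} (p : B → Bool) (f : A → B) xs → tally p (map f xs) ≡ tally (p ∘ f) xs
tally-map p f []       = refl
tally-map p f (x ∷ xs) with p (f x)
... | true  = cong suc (tally-map p f xs)
... | false = tally-map p f xs

tally-cong : ∀ {A : Set} {p r : A → Bool} → p ≗ r → tally p ≗ tally r
tally-cong         p≗r []       = refl
tally-cong {r = r} p≗r (x ∷ xs) rewrite p≗r x | tally-cong p≗r xs = refl

tally-none : ∀ {A : Set} (xs : List A) → tally (λ _ → false) xs ≡ 0
tally-none []       = refl
tally-none (x ∷ xs) = tally-none xs

tally-split : ∀ {A : Set} (b p : A → Bool) xs →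
  tally p xs ≡ tally (λ x → not (b x) ∧ p x) xs + tally (λ x → b x ∧ p x) xs
tally-split b p []       = refl
tally-split b p (x ∷ xs) with b x | p x
... | true  | true  = trans (cong suc (tally-split b p xs)) (sym (+-suc _ _))
... | false | true  = cong suc (tally-split b p xs)
... | true  | false = tally-split b p xs
... | false | false = tally-split b p xs

tally-filter : ∀ {A : Set} {P Q : A → Set} (P? : Decidable P) (Q? : Decidable Q) xs →
  length (filter Q? (filter P? xs)) ≡ tally (λ x → does (P? x) ∧ does (Q? x)) xs
tally-filter P? Q? []       = refl
tally-filter P? Q? (x ∷ xs) with does (P? x)
... | false = tally-filter P? Q? xs
... | true with does (Q? x)
...   | true  = cong suc (tally-filter P? Q? xs)
...   | false = tally-filter P? Q? xs

allowed : Direction → Bool → Bool → Bool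
allowed up   x y = x ∨ not y
allowed down x y = not x ∨ y

headOr : ∀ {n} → Bool → Vec Bool n → Bool
headOr e []      = e
headOr e (x ∷ _) = x

-- The bit `e` follows the last one. It stays free, to match a matrix entry, until `tally-R` equates
-- it with the first bit; closing the string to a cycle is taking the trace.
fits : ∀ {n} → Bool → Vec Direction n → Subset n → Bool
fits e []       []      = true
fits e (d ∷ ds) (x ∷ I) = allowed d x (headOr e I) ∧ fits e ds I

_is_ : Bool → Bool → Bool
true  is x = x
false is x = not x

fitting : ∀ {n} → Bool → Vec Direction n → ℕ → Subset n → Bool
fitting e ds k I = fits e ds I ∧ does (∣ I ∣ ≟ k)

entry : ∀ {n} → Bool → Bool → Vec Direction n → Polynomial
entry x e ds k = tally (λ I → (x is headOr e I) ∧ fitting e ds k I) (subsets _)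

at : Bool → Bool → Matrix → Polynomial
at false false = m₀₀
at false true  = m₀₁
at true  false = m₁₀
at true  true  = m₁₁

at-up : ∀ e A → at false e (letter up A) ≡ at false e A
at-up false A = refl
at-up true  A = refl

at-up′ : ∀ e A → at true e (letter up A) ≡ q ⊛ (at false e A ⊕ at true e A)
at-up′ false A = refl
at-up′ true  A = refl

at-down : ∀ e A → at false e (letter down A) ≡ at false e A ⊕ at true e A
at-down false A = refl
at-down true  A = refl

at-down′ : ∀ e A → at true e (letter down A) ≡ q ⊛ at true e A
at-down′ false A = refl
at-down′ true  A = refl

tally-subsets : ∀ {n} (p : Subset (suc n) → Bool) →
  tally p (subsets (suc n)) ≡
  tally (p ∘ (outside ∷_)) (subsets n) + tally (p ∘ (inside ∷_)) (subsets n)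
tally-subsets {n} p = trans (tally-++ p (map (outside ∷_) (subsets n)) _)
  (cong₂ _+_ (tally-map p (outside ∷_) (subsets n)) (tally-map p (inside ∷_) (subsets n)))

module _ {n} (e : Bool) (ds : Vec Direction n) where

  outside-up : ∀ k → tally (fitting e (up ∷ ds) k ∘ (outside ∷_)) (subsets n) ≡ entry false e ds k
  outside-up k = tally-cong (λ I → ∧-assoc (not (headOr e I)) (fits e ds I) _) (subsets n)

  outside-down : ∀ k → tally (fitting e (down ∷ ds) k ∘ (outside ∷_)) (subsets n) ≡
                       entry false e ds k + entry true e ds k
  outside-down k = tally-split (headOr e) (fitting e ds k) (subsets n)

  inside-zero : ∀ d → tally (fitting e (d ∷ ds) 0 ∘ (inside ∷_)) (subsets n) ≡ 0
  inside-zero d = trans (tally-cong (λ I → ∧-zeroʳ _) (subsets n)) (tally-none (subsets n))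

  inside-up : ∀ k → tally (fitting e (up ∷ ds) (suc k) ∘ (inside ∷_)) (subsets n) ≡
                    entry false e ds k + entry true e ds k
  inside-up k = tally-split (headOr e) (fitting e ds k) (subsets n)

  inside-down : ∀ k → tally (fitting e (down ∷ ds) (suc k) ∘ (inside ∷_)) (subsets n) ≡
                      entry true e ds k
  inside-down k = tally-cong (λ I → ∧-assoc (headOr e I) (fits e ds I) _) (subsets n)

  entry-outside : ∀ d k → entry false e (d ∷ ds) k ≡
                  tally (fitting e (d ∷ ds) k ∘ (outside ∷_)) (subsets n)
  entry-outside d k = trans (tally-subsets {n} _) (trans
    (cong (tally (fitting e (d ∷ ds) k ∘ (outside ∷_)) (subsets n) +_) (tally-none (subsets n)))
    (+-identityʳ _))

  entry-inside : ∀ d k → entry true e (d ∷ ds) k ≡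
                 tally (fitting e (d ∷ ds) k ∘ (inside ∷_)) (subsets n)
  entry-inside d k = trans (tally-subsets {n} _)
    (cong (_+ tally (fitting e (d ∷ ds) k ∘ (inside ∷_)) (subsets n)) (tally-none (subsets n)))

-- Given the first bit, the first step either forces the second bit or leaves it free; these are the
-- rows of `letter` with one and with two summands.
entry-matrix : ∀ x e {n} (ds : Vec Direction n) → entry x e ds ≗ at x e (matrix (Vec.toList ds))
entry-matrix false false [] zero    = refl
entry-matrix false false [] (suc k) = refl
entry-matrix false true  [] k       = refl
entry-matrix true  false [] k       = refl
entry-matrix true  true  [] zero    = refl
entry-matrix true  true  [] (suc k) = refl
entry-matrix false e (up ∷ ds) k = trans (entry-outside e ds up k) (trans (outside-up e ds k)
  (trans (entry-matrix false e ds k) (sym (cong-app (at-up e _) k))))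
entry-matrix false e (down ∷ ds) k = trans (entry-outside e ds down k) (trans (outside-down e ds k)
  (trans (cong₂ _+_ (entry-matrix false e ds k) (entry-matrix true e ds k))
    (sym (cong-app (at-down e _) k))))
entry-matrix true e (d ∷ ds) zero = trans (entry-inside e ds d 0) (trans (inside-zero e ds d)
  (sym (at-zero d e)))
  where
  at-zero : ∀ d e {A} → at true e (letter d A) 0 ≡ 0
  at-zero up   false = refl
  at-zero up   true  = refl
  at-zero down false = refl
  at-zero down true  = refl
entry-matrix true e (up ∷ ds) (suc k) = trans (entry-inside e ds up (suc k)) (trans
  (inside-up e ds k)
  (trans (cong₂ _+_ (entry-matrix false e ds k) (entry-matrix true e ds k))
    (trans (sym (q-suc _ k)) (sym (cong-app (at-up′ e _) (suc k))))))
entry-matrix true e (down ∷ ds) (suc k) = trans (entry-inside e ds down (suc k)) (trans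
  (inside-down e ds k)
  (trans (entry-matrix true e ds k)
    (trans (sym (q-suc _ k)) (sym (cong-app (at-down′ e _) (suc k))))))

tally-R : ∀ {n} (ds : Vec Direction (suc n)) k →
  tally (λ I → fitting (head I) ds k I) (subsets (suc n)) ≡ R (Vec.toList ds) k
tally-R ds@(d ∷ ds′) k = trans (tally-subsets (λ I → fitting (head I) ds k I)) (cong₂ _+_
  (trans (sym (entry-outside false ds′ d k)) (entry-matrix false false ds k))
  (trans (sym (entry-inside true ds′ d k)) (entry-matrix true true ds k)))

after : ∀ {n} → Bool → Subset n → Fin n → Bool
after e (x ∷ I) zero    = headOr e I
after e (x ∷ I) (suc i) = after e I i

after-inject₁ : ∀ {n} e (I : Subset (suc n)) j → after e I (inject₁ j) ≡ lookup I (suc j)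
after-inject₁ e (x ∷ y ∷ I) zero    = refl
after-inject₁ e (x ∷ y ∷ I) (suc j) = after-inject₁ e (y ∷ I) j

after-fromℕ : ∀ {n} e (I : Subset (suc n)) → after e I (fromℕ n) ≡ e
after-fromℕ e (x ∷ [])    = refl
after-fromℕ e (x ∷ y ∷ I) = after-fromℕ e (y ∷ I)

after-next : ∀ {n} (I : Subset (suc n)) i → after (head I) I i ≡ lookup I (next i)
after-next {n} I@(x ∷ _) i with view i
... | ‵inject₁ j rewrite next-inject₁ j = after-inject₁ x I j
... | ‵fromℕ     rewrite next-fromℕ n   = after-fromℕ x I

fits⇒allowed : ∀ {n} e (ds : Vec Direction n) I → T (fits e ds I) →
               ∀ i → T (allowed (lookup ds i) (lookup I i) (after e I i))
fits⇒allowed e (d ∷ ds) (x ∷ I) t zero    = proj₁ (Equivalence.to T-∧ t)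
fits⇒allowed e (d ∷ ds) (x ∷ I) t (suc i) =
  fits⇒allowed e ds I (proj₂ (Equivalence.to (T-∧ {allowed d x (headOr e I)}) t)) i

allowed⇒fits : ∀ {n} e (ds : Vec Direction n) I →
               (∀ i → T (allowed (lookup ds i) (lookup I i) (after e I i))) → T (fits e ds I)
allowed⇒fits e []       []      a = tt
allowed⇒fits e (d ∷ ds) (x ∷ I) a = Equivalence.from T-∧ (a zero , allowed⇒fits e ds I (a ∘ suc))

module _ {n} (ds : Vec Direction (suc n)) (I : Subset (suc n)) where

  LowerSet : Set
  LowerSet = ∀ x y → x ≼[ ds ] y → y ∈ I → x ∈ I

  lower⇒fits : LowerSet → T (fits (head I) ds I)
  lower⇒fits lower = allowed⇒fits (head I) ds I λ i →
    subst (T ∘ allowed (lookup ds i) (lookup I i)) (sym (after-next I i)) (step i)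
    where
    step : ∀ i → T (allowed (lookup ds i) (lookup I i) (lookup I (next i)))
    step i with lookup ds i in ds≡ | lookup I i in I≡ | lookup I (next i) in I′≡
    ... | up   | true  | _     = tt
    ... | up   | false | false = tt
    ... | up   | false | true  = contradiction (trans (sym I≡)
      ([]=⇒lookup (lower i (next i) (ascend ds≡ ◅ ε) (lookup⇒[]= (next i) I I′≡)))) λ ()
    ... | down | false | _     = tt
    ... | down | true  | true  = tt
    ... | down | true  | false = contradiction (trans (sym I′≡)
      ([]=⇒lookup (lower (next i) i (descend ds≡ ◅ ε) (lookup⇒[]= i I I≡)))) λ ()

  fits⇒lower : T (fits (head I) ds I) → LowerSet
  fits⇒lower t x .x ε          x∈I = x∈I
  fits⇒lower t x y  (s ◅ x≼y) y∈I = back s (fits⇒lower t _ y x≼y y∈I)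
    where
    ok : ∀ i → T (allowed (lookup ds i) (lookup I i) (lookup I (next i)))
    ok i = subst (T ∘ allowed (lookup ds i) (lookup I i)) (after-next I i)
      (fits⇒allowed (head I) ds I t i)
    back : ∀ {i j} → Step ds i j → j ∈ I → i ∈ I
    back (ascend {i} p) j∈I with lookup I i in I≡ | ok i
    ... | true  | _ = lookup⇒[]= i I I≡
    ... | false | a rewrite p | []=⇒lookup j∈I = ⊥-elim a
    back (descend {i} p) j∈I with lookup I (next i) in I≡ | ok i
    ... | true  | _ = lookup⇒[]= (next i) I I≡
    ... | false | a rewrite p | []=⇒lookup j∈I = ⊥-elim a

rankPolynomial-R : ∀ {n} (ds : Vec Direction n) → 0 < n →
  (po : IsDecPartialOrder _≡_ (λ i j → i ≼[ ds ] j)) →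
  rankPolynomial (record { isDecPartialOrder = po }) ≗ R (Vec.toList ds)
rankPolynomial-R {suc n} ds _ po k = trans
  (tally-filter (isLowerIdeal? P) (λ I → ∣ I ∣ ≟ k) (subsets (suc n)))
  (trans (tally-cong (λ I → cong (_∧ does (∣ I ∣ ≟ k))
      (does-⇔ (mk⇔ (lower⇒fits ds I) (fits⇒lower ds I)) (isLowerIdeal? P I) (T? (fits (head I) ds I))))
    (subsets (suc n)))
  (tally-R ds k))
  where
  P : FinPoset (suc n)
  P = record { isDecPartialOrder = po }

-- Unimodality of the rank polynomial

R-positive : ∀ w → 0 < R w 0
R-positive w = ≤-trans (corner w) (m≤m+n _ _)
  where
  corner : ∀ w → 0 < m₀₀ (matrix w) 0
  corner []         = s≤s z≤n
  corner (up   ∷ w) = corner w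
  corner (down ∷ w) = ≤-trans (corner w) (m≤m+n _ _)

-- The constant term, reflected, is the leading coefficient; its being positive fixes the degree as
-- `n`.
unimodal : ∀ {n r} → Palindromic n r → Rising n r → 0 < r 0 → Unimodal r
unimodal {n} {r} p s 0<r₀ =
  n , (r-n≢0 , vanishes p) , ⌊ n /2⌋ , ⌊n/2⌋≤n n , ascending , descending
  where
  r-n≢0 : r n ≢ 0
  r-n≢0 r-n≡0 = <-irrefl (trans (sym r-n≡0) (symmetric p n 0 (+-identityʳ n))) 0<r₀
  ascending : ∀ k → k < ⌊ n /2⌋ → r k ≤ r (suc k)
  ascending k k<m = s (suc k) k (n≤1+n k) (≤-trans
    (+-mono-≤ k<m (≤-trans (<⇒≤ k<m) (⌊n/2⌋≤⌈n/2⌉ n)))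
    (≤-reflexive (⌊n/2⌋+⌈n/2⌉≡n n)))
  descending : ∀ k → ⌊ n /2⌋ ≤ k → k < n → r (suc k) ≤ r k
  -- Reflection turns the descent from `k` to `k + 1` into the ascent from `j = n - k - 1` to
  -- `j + 1`, which lies in the lower half because `j ≤ k`.
  descending k m≤k k<n = subst₂ _≤_
    (symmetric p j (suc k) (trans (+-comm j (suc k)) k+j≡n))
    (symmetric p (suc j) k (trans (+-comm (suc j) k) (trans (+-suc k j) k+j≡n)))
    (s (suc j) j (n≤1+n j) (≤-trans (+-monoʳ-≤ (suc j) j≤k) (≤-reflexive
      (trans (cong suc (+-comm j k)) k+j≡n))))
    where
    j = n ∸ suc k
    k+j≡n : suc k + j ≡ n
    k+j≡n = m+[n∸m]≡n k<n
    j≤k : j ≤ k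
    j≤k = +-cancelˡ-≤ (suc k) j k (begin
      suc k + j             ≡⟨ k+j≡n ⟩
      n                     ≡⟨ ⌊n/2⌋+⌈n/2⌉≡n n ⟨
      ⌊ n /2⌋ + ⌈ n /2⌉     ≤⟨ +-mono-≤ m≤k (≤-trans (⌊n/2⌋-mono (n≤1+n (suc n))) (s≤s m≤k)) ⟩
      k + suc k             ≡⟨ +-suc k k ⟩
      suc k + k             ∎)
      where open ≤-Reasoning

parts : List Block → List ℕ
parts []            = []
parts ((a , c) ∷ L) = suc a ∷ suc c ∷ parts L

blocks-of : ∀ cs → All (0 <_) cs → 2 ∣ length cs → ∃[ L ] cs ≡ parts L
blocks-of []               _                  _    = [] , refl
blocks-of (a ∷ [])         _                  even = contradiction (∣⇒≤ even) λ { (s≤s ()) }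
blocks-of (suc a ∷ suc c ∷ cs) (_ ∷ _ ∷ 0<cs) even with blocks-of cs 0<cs (∣m+n∣m⇒∣n even ∣-refl)
... | L , refl = (a , c) ∷ L , refl

steps-parts : ∀ L → Vec.toList (steps up (parts L)) ≡ blockWord L
steps-parts []            = refl
steps-parts ((a , c) ∷ L) = trans (toList-run (suc a) up _)
  (cong (replicate (suc a) up ++_) (trans (toList-run (suc c) down _)
    (cong (replicate (suc c) down ++_) (steps-parts L))))
  where
  toList-run : ∀ n d {m} (ds : Vec Direction m) →
               Vec.toList (Vec.replicate n d Vec.++ ds) ≡ replicate n d ++ Vec.toList ds
  toList-run n d ds = trans (toList-++ (Vec.replicate n d) ds)
    (cong (_++ Vec.toList ds) (toList-replicate n d))

rising-cycle : ∀ b L → ¬ (∃[ a ] 0 < a ×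
    (parts (b ∷ L) ≡ a ∷ 1 ∷ a ∷ 1 ∷ [] ⊎ parts (b ∷ L) ≡ 1 ∷ a ∷ 1 ∷ a ∷ [])) →
  RisingCycle (b ∷ L)
rising-cycle (a , c) []            _    = rising₁ a c
rising-cycle (a , c) ((b , d) ∷ []) ¬exc = rising₂ a c b d λ
  { (inj₁ (refl , refl , refl)) → ¬exc (suc a , s≤s z≤n , inj₁ refl)
  ; (inj₂ (refl , refl , refl)) → ¬exc (suc c , s≤s z≤n , inj₂ refl) }
rising-cycle b₁ (b₂ ∷ b₃ ∷ L) _ = rising-long (length L) (b₁ ∷ b₂ ∷ b₃ ∷ L) refl

theorem5p1 : (c : Composition) (even : 2 ∣ length (Composition.parts c)) →
    ¬ (∃[ a ] 0 < a × (Composition.parts c ≡ a ∷ 1 ∷ a ∷ 1 ∷ [] ⊎ Composition.parts c ≡ 1 ∷ a ∷ 1 ∷ a ∷ [])) →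
    Unimodal (rankPolynomial (circularFence c even))
theorem5p1 c even ¬exc with blocks-of (Composition.parts c) (Composition.positive c) even
-- The empty poset is treated apart: its rank polynomial is 1, while the trace of the identity
-- matrix is 2.
theorem5p1 record { positive = [] } even ¬exc | [] , refl =
  0 , ((λ ()) , λ { (suc k) _ → refl }) , 0 , z≤n , (λ _ ()) , λ _ _ ()
theorem5p1 record { positive = pos } even ¬exc | b ∷ L , refl = unimodal
  (palindromic-≗ (λ k → sym (rank k)) (palindromic-blocks (b ∷ L)))
  (rising-≗ (λ k → sym (rank k)) (rising-cycle b L ¬exc))
  (subst (0 <_) (sym (rank 0)) (R-positive (blockWord (b ∷ L))))
  where
  rank : rankPolynomial (circularFence (record { parts = parts (b ∷ L) ; positive = pos }) even) ≗
         R (blockWord (b ∷ L))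
  rank k = trans (rankPolynomial-R (steps up (parts (b ∷ L))) (s≤s z≤n)
      (steps-isDecPartialOrder (parts (b ∷ L)) pos even) k)
    (cong (λ w → R w k) (steps-parts (b ∷ L)))
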